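{- $n_4(7) \leq 77$; that is, there exists a triangle-free graph on $77$ vertices with chromatic number $7$.
   Context: All graphs are finite and simple. The girth of a graph is the length of its shortest cycle; a graph has girth at least $4$ iff it is triangle-free. For integers $g$ and $k$, $n_g(k)$ denotes the smallest order of a graph with chromatic number exactly $k$ and girth at least $g$. -}

module Defs where

open import Data.Nat using (ℕ)
open import Data.Fin using (Fin)
open import Data.Bool using (Bool; true; false)
open import Data.Product using (Σ; _×_)
open import Relation.Binary.PropositionalEquality using (_≡_; _≢_)
open import Relation.Nullary using (¬_)
open import Data.Empty using (⊥)

record Graph (n : ℕ) : Set where
  field
    adj   : Fin n → Fin n → Bool
    sym   : ∀ u v → adj u v ≡ adj v u
    irrefl : ∀ v → adj v v ≡ false
open Graph public

Adj : ∀ {n} → Graph n → Fin n → Fin n → Set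
Adj G u v = adj G u v ≡ true

TriangleFree : ∀ {n} → Graph n → Set
TriangleFree {n} G = ∀ (u v w : Fin n) → Adj G u v → Adj G v w → Adj G u w → ⊥

ProperColouring : ∀ {n} → Graph n → (k : ℕ) → (Fin n → Fin k) → Set
ProperColouring {n} G k c = ∀ (u v : Fin n) → Adj G u v → c u ≢ c v

Colourable : ∀ {n} → Graph n → ℕ → Set
Colourable {n} G k = Σ (Fin n → Fin k) (ProperColouring G k)

HasChromaticNumber : ∀ {n} → Graph n → ℕ → Set
HasChromaticNumber G ℕ.zero = Colourable G ℕ.zero
HasChromaticNumber G (ℕ.suc m) = Colourable G (ℕ.suc m) × ¬ Colourable G m

{-# OPTIONS --safe #-}
module Submission where

-- Let G be a triangle-free graph of chromatic number 6 on 40 vertices; its Mycielskian has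
-- 81 vertices.  Let D₁ and D₂ be triples of vertices of G that are completely joined to each
-- other.  Omit the copies of the six vertices of D = D₁ ∪ D₂ and add two vertices z₁ and z₂
-- instead, where zᵢ is joined to Dᵢ and to every copy without a neighbour in Dᵢ.  The
-- resulting graph H has 77 vertices.
--
-- Given a 6-colouring of H, let J be the set of the vertices in D that have the colour of the
-- apex; it is contained in D₁ or in D₂.  Every other vertex with that colour is recoloured with
-- the colour of a copy that is joined to all its neighbours.  This leaves a 5-colouring of the
-- graph K_J, which arises from H − J by deleting the apex and all edges between a copy and a
-- vertex outside D ∪ N(J).  For each of the 15 sets J it is computed that K_J has no
-- 5-colouring: one may assume that the colour class of a fixed vertex is a maximal independent
-- set, and the complement of each such set contains one of the listed sets, which are shown
-- in the same way not to be 4-colourable.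

-- In the Mycielskian every vertex of G has a copy, so that a vertex with the colour of the apex can
-- always be recoloured, and a 6-colouring yields a 5-colouring of G. A vertex of D has no copy; if
-- it has that colour it can only be deleted, and nothing prevents G - J from being 5-colourable.
-- What makes up for the loss is that the vertices of D outside J and the neighbours of J certainly
-- do not have the colour of the apex. They keep their own colours, so that even their edges to the
-- copies survive the recolouring. If J is a nonempty subset of Dᵢ, then zᵢ is one of these
-- neighbours; it is joined to exactly those copies that form no triangle with it and a vertex of
-- Dᵢ. All finite facts are established by evaluation, which shapes the encoding: for products of
-- primes, membership or containment is one remainder of large numbers, and the union of
-- neighbourhoods is a product.

open import Defs
open import Data.Product using (Σ; _×_)

open import Agda.Builtin.Nat using (mod-helper; div-helper) renaming (_<_ to _<ᵇ_)
open import Data.Bool.Base using (Bool; true; false; _∧_; _∨_; _xor_; not; if_then_else_)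
open import Data.Bool.Properties using (∧-conicalˡ; ∧-conicalʳ; T-≡)
import Data.Bool.Properties as Bool
open import Data.Empty using (⊥; ⊥-elim)
open import Data.Fin.Base using (Fin; zero; suc; toℕ)
import Data.Fin.Properties as Fin
open import Data.List.Base using (List; []; _∷_; _++_; length; map; filter; upTo; allFin; concat; concatMap)
open import Data.Bool.ListAction using (all; any)
open import Data.List.Membership.Propositional using (_∈_; find; lose)
open import Data.List.Membership.Propositional.Properties using (∈-++⁻; ∈-++⁺ˡ; ∈-++⁺ʳ; ∈-filter⁺; ∈-filter⁻; ∈-map⁻; ∈-map⁺; ∈-upTo⁺; ∈-allFin; ∈-concatMap⁻)
open import Data.List.Properties using (≡-dec)
open import Data.List.Relation.Unary.Any as Any using (Any; here; there)
open import Data.List.Relation.Unary.All as All using (All; []; _∷_)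
open import Data.Nat.Base using (ℕ; zero; suc; _+_; _*_; _∸_; _^_; _≡ᵇ_)
open import Data.Nat.Divisibility using (_∣_; _∣?_; ∣-trans; m∣m*n; n∣m*n; m%n≡0⇒n∣m; n∣m⇒m%n≡0; ∣1⇒≡1)
open import Data.Nat.Primality using (Prime; prime?; euclidsLemma; prime⇒irreducible; ¬prime[1])
open import Data.Nat.DivMod using (_mod_; m<n⇒m%n≡m)
import Data.Nat.Properties as ℕ
open import Data.Product using (_,_; proj₁; proj₂; ∃)
open import Data.Sum.Base using (_⊎_; inj₁; inj₂; [_,_]′)
import Data.Sum.Base as Sum
open import Function.Base using (_∘_; id)
open import Function.Bundles using (Equivalence)
open import Relation.Binary.Definitions using (DecidableEquality)
open import Relation.Binary.PropositionalEquality using (_≡_; _≢_; refl; trans; cong; cong₂; subst) renaming (sym to ≡-sym)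
open import Relation.Nullary.Decidable using (Dec; yes; no; map′; ⌊_⌋; toWitness; fromWitness; _×-dec_; ¬?)
open import Relation.Nullary.Negation using (¬_; contradiction)
import Data.List.Membership.DecPropositional as DecMembership

-- Finite sets of vertices as products of primes.

-- A vertex is given by its code m, standing for the prime suc m, and by the
-- product nb of the primes of its neighbours.  Besides, suc s is the power of 32
-- assigned to the vertex and w is the sum of those of its neighbours; these two
-- only serve to choose promising vertices.
data Vertex : Set where
  vx : (m nb w s : ℕ) → Vertex

code nbhd : Vertex → ℕ
code (vx m _ _ _)  = m
nbhd (vx _ nb _ _) = nb

infix 4 _∈ₛ_
_∈ₛ_ : Vertex → ℕ → Set
u ∈ₛ g = suc (code u) ∣ g

Adj′ : Vertex → Vertex → Set
Adj′ u v = u ∈ₛ nbhd v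

_≟ᵥ_ : DecidableEquality Vertex
vx a b c d ≟ᵥ vx a′ b′ c′ d′ = map′
  (λ { (refl , refl , refl , refl) → refl }) (λ { refl → refl , refl , refl , refl })
  (a ℕ.≟ a′ ×-dec b ℕ.≟ b′ ×-dec c ℕ.≟ c′ ×-dec d ℕ.≟ d′)

open DecMembership _≟ᵥ_ using (_∈?_)

-- In continuation-passing style no pair is built, and `split′` matches on the remainder, so that
-- each membership is decided by a single division.
split : ℕ → List Vertex → List Vertex → List Vertex → (List Vertex → List Vertex → Bool) → Bool
split′ : ℕ → ℕ → Vertex → List Vertex → List Vertex → List Vertex → (List Vertex → List Vertex → Bool) → Bool
split g [] Y N k = k Y N
split g (u@(vx m _ _ _) ∷ L) Y N k = split′ (mod-helper 0 m g m) g u L Y N k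
split′ zero    g u L Y N k = split g L (u ∷ Y) N k
split′ (suc _) g u L Y N k = split g L Y (u ∷ N) k

record Split (g : ℕ) (L Y₀ N₀ Y N : List Vertex) : Set where
  field
    yes⁺ : ∀ {u} → u ∈ L → u ∈ₛ g → u ∈ Y
    yes⁻ : ∀ {u} → u ∈ Y → u ∈ Y₀ ⊎ u ∈ L × u ∈ₛ g
    no⁺  : ∀ {u} → u ∈ L → ¬ u ∈ₛ g → u ∈ N
    no⁻  : ∀ {u} → u ∈ N → u ∈ N₀ ⊎ u ∈ L × ¬ u ∈ₛ g
    keep : ∀ {u} → u ∈ N₀ → u ∈ N
    keepʸ : ∀ {u} → u ∈ Y₀ → u ∈ Y

split-sound : ∀ g L Y₀ N₀ k → split g L Y₀ N₀ k ≡ true →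
              ∃ λ Y → ∃ λ N → k Y N ≡ true × Split g L Y₀ N₀ Y N
split-sound g [] Y₀ N₀ k t = Y₀ , N₀ , t , record
  { yes⁺ = λ () ; yes⁻ = inj₁ ; no⁺ = λ () ; no⁻ = inj₁ ; keep = id ; keepʸ = id }
split-sound g (u@(vx m _ _ _) ∷ L) Y₀ N₀ k t with mod-helper 0 m g m in eq
... | zero =
  let u∈g = m%n≡0⇒n∣m g (suc m) eq
      Y , N , t′ , S = split-sound g L (u ∷ Y₀) N₀ k t
      open Split S
  in Y , N , t′ , record
  { yes⁺ = λ { (here refl) _ → keepʸ (here refl) ; (there p) → yes⁺ p }
  ; yes⁻ = λ p → [ (λ { (here refl) → inj₂ (here refl , u∈g) ; (there q) → inj₁ q }) , (λ (q , r) → inj₂ (there q , r)) ]′ (yes⁻ p)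
  ; no⁺  = λ { (here refl) u∉g → contradiction u∈g u∉g ; (there p) → no⁺ p }
  ; no⁻  = λ p → Sum.map₂ (λ (q , r) → there q , r) (no⁻ p)
  ; keep = keep ; keepʸ = λ p → keepʸ (there p) }
... | suc _ =
  let u∉g : ¬ u ∈ₛ g
      u∉g = λ u∈g → contradiction (trans (≡-sym eq) (n∣m⇒m%n≡0 g (suc m) u∈g)) λ ()
      Y , N , t′ , S = split-sound g L Y₀ (u ∷ N₀) k t
      open Split S
  in Y , N , t′ , record
  { yes⁺ = λ { (here refl) u∈g → contradiction u∈g u∉g ; (there p) → yes⁺ p }
  ; yes⁻ = λ p → Sum.map₂ (λ (q , r) → there q , r) (yes⁻ p)
  ; no⁺  = λ { (here refl) _ → keep (here refl) ; (there p) → no⁺ p }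
  ; no⁻  = λ p → [ (λ { (here refl) → inj₂ (here refl , u∉g) ; (there q) → inj₁ q }) , (λ (q , r) → inj₂ (there q , r)) ]′ (no⁻ p)
  ; keep = λ p → keep (there p) ; keepʸ = keepʸ }

-- Search over the maximal independent sets.

Test : Set
Test = List Vertex → Bool

-- P: vertices that may still be chosen, X: rejected vertices without a chosen
-- neighbour, E: vertices with a chosen neighbour.  The test o is run on the
-- complement of every maximal independent set.
search : Test → ℕ → List Vertex → List Vertex → List Vertex → Bool
loop : Test → ℕ → List Vertex → List Vertex → List Vertex → List Vertex → Bool
search o zero P X E = false
search o (suc n) [] [] E = o E
-- A rejected vertex can no longer get a chosen neighbour, so no maximal independent set lies on
-- this branch.
search o (suc n) [] (_ ∷ _) E = true
-- Either `p` is chosen or, by maximality, one of its neighbours `Q` is.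
search o (suc n) (p ∷ P) [] E = split (nbhd p) P [] [] λ Q R → search o n R [] (Q ++ E) ∧ loop o n Q R (p ∷ []) E
-- Some neighbour of the rejected `x` must be chosen, so it is enough to branch on `Q`.
search o (suc n) P@(_ ∷ _) X@(x ∷ _) E = split (nbhd x) P [] [] λ Q R → loop o n Q R X E
loop o n [] R X E = true
loop o n (q ∷ Q) R X E =
  split (nbhd q) (Q ++ R) E [] (λ E₁ P → split (nbhd q) X E₁ [] λ E₂ X₁ → search o n P X₁ E₂) ∧ loop o n Q R (q ∷ X) E

from : Test → Vertex → Test
-- 64 bounds the depth: each nested call of `search` follows the choice of another vertex, and
-- running out gives `false`.
from o v L = split (nbhd v) L [] [] λ E P → search o 64 P [] E

module Search
  (S M : Vertex → Set) (M? : ∀ u → Dec (M u)) (M⇒S : ∀ {u} → M u → S u)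
  (symm : ∀ {u v} → S u → S v → Adj′ u v → Adj′ v u)
  (indep : ∀ {u v} → M u → M v → ¬ Adj′ u v)
  (maximal : ∀ {u} → S u → M u ⊎ ∃ λ v → M v × Adj′ v u)
  (o : Test) (o-sound : ∀ E → (∀ {u} → u ∈ E → S u × ¬ M u) → o E ≢ true)
  where

  Out : Vertex → Set
  Out u = S u × ¬ M u

  -- It suffices to follow the one branch that agrees with `M`. A rejected vertex has a neighbour in
  -- `M`; this is not among the chosen vertices, hence it is still available, and so the loop meets
  -- an element of `M` before it ends. At the leaf `E` is disjoint from `M`, and `o-sound` applies.
  search-sound : ∀ n P X E (Chosen : Vertex → Set) →
    (∀ {u} → u ∈ P → S u) → (∀ {u} → u ∈ X → Out u) → (∀ {u} → u ∈ E → Out u) →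
    (∀ {u} → M u → Chosen u ⊎ u ∈ P) →
    (∀ {u v} → Chosen u → v ∈ P ⊎ v ∈ X → ¬ Adj′ u v) →
    search o n P X E ≢ true
  loop-sound : ∀ n Q R X E (Chosen : Vertex → Set) →
    (∀ {u} → u ∈ Q ++ R → S u) → (∀ {u} → u ∈ X → Out u) → (∀ {u} → u ∈ E → Out u) →
    (∀ {u} → M u → Chosen u ⊎ u ∈ Q ++ R) →
    (∀ {u v} → Chosen u → v ∈ Q ++ R ⊎ v ∈ X → ¬ Adj′ u v) →
    (∃ λ q → q ∈ Q × M q) →
    loop o n Q R X E ≢ true

  search-sound zero P X E C inP inX inE cov far ()
  search-sound (suc n) [] [] E C inP inX inE cov far t = o-sound E inE t
  search-sound (suc n) [] (x ∷ X) E C inP inX inE cov far t with maximal (proj₁ (inX (here refl)))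
  ... | inj₁ Mx = proj₂ (inX (here refl)) Mx
  ... | inj₂ (u , Mu , a) with cov Mu
  ...   | inj₁ c = far c (inj₂ (here refl)) a
  search-sound (suc n) (p ∷ P) [] E C inP inX inE cov far t with split-sound (nbhd p) P [] [] _ t
  ... | Q , R , t′ , Sp with M? p
  ...   | yes Mp = search-sound n R [] (Q ++ E) (λ u → C u ⊎ u ≡ p)
            (λ r → inP (there (R⊆P r))) (λ ())
            (λ e → [ (λ q → inP (there (proj₁ (Q⊆P q))) , λ Mu → indep Mu Mp (proj₂ (Q⊆P q))) , inE ]′ (∈-++⁻ Q e))
            cov′ far′ (∧-conicalˡ _ _ t′)
    where
    open Split Sp
    R⊆P : ∀ {u} → u ∈ R → u ∈ P
    R⊆P r with no⁻ r
    ... | inj₂ (q , _) = q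
    Q⊆P : ∀ {u} → u ∈ Q → u ∈ P × Adj′ u p
    Q⊆P r with yes⁻ r
    ... | inj₂ q = q
    cov′ : ∀ {u} → M u → (C u ⊎ u ≡ p) ⊎ u ∈ R
    cov′ Mu with cov Mu
    ... | inj₁ c = inj₁ (inj₁ c)
    ... | inj₂ (here refl) = inj₁ (inj₂ refl)
    ... | inj₂ (there q) = inj₂ (no⁺ q (indep Mu Mp))
    far′ : ∀ {u v} → C u ⊎ u ≡ p → v ∈ R ⊎ v ∈ [] → ¬ Adj′ u v
    far′ (inj₁ c) (inj₁ r) a = far c (inj₁ (there (R⊆P r))) a
    far′ (inj₂ refl) (inj₁ r) a with no⁻ r
    ... | inj₂ (q , na) = na (symm (inP (here refl)) (inP (there q)) a)
  ...   | no ¬Mp = loop-sound n Q R (p ∷ []) E C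
            (λ r → inP (there (QR⊆P r))) (λ { (here refl) → inP (here refl) , ¬Mp }) inE
            cov′ far′ ex (∧-conicalʳ _ _ t′)
    where
    open Split Sp
    QR⊆P : ∀ {u} → u ∈ Q ++ R → u ∈ P
    QR⊆P r with ∈-++⁻ Q r
    ... | inj₁ q with yes⁻ q
    ...   | inj₂ (q′ , _) = q′
    QR⊆P r | inj₂ q with no⁻ q
    ...   | inj₂ (q′ , _) = q′
    P⊆QR : ∀ {u} → u ∈ P → u ∈ Q ++ R
    P⊆QR {u} q with suc (code u) ∣? nbhd p
    ... | yes a = ∈-++⁺ˡ (yes⁺ q a)
    ... | no na = ∈-++⁺ʳ Q (no⁺ q na)
    cov′ : ∀ {u} → M u → C u ⊎ u ∈ Q ++ R
    cov′ Mu with cov Mu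
    ... | inj₁ c = inj₁ c
    ... | inj₂ (here refl) = contradiction Mu ¬Mp
    ... | inj₂ (there q) = inj₂ (P⊆QR q)
    far′ : ∀ {u v} → C u → v ∈ Q ++ R ⊎ v ∈ p ∷ [] → ¬ Adj′ u v
    far′ c (inj₁ r) = far c (inj₁ (there (QR⊆P r)))
    far′ c (inj₂ (here refl)) = far c (inj₁ (here refl))
    ex : ∃ λ q → q ∈ Q × M q
    ex with maximal (inP (here refl))
    ... | inj₁ Mp = contradiction Mp ¬Mp
    ... | inj₂ (u , Mu , a) with cov Mu
    ...   | inj₁ c = ⊥-elim (far c (inj₁ (here refl)) a)
    ...   | inj₂ (here refl) = contradiction Mu ¬Mp
    ...   | inj₂ (there q) = u , yes⁺ q a , Mu
  search-sound (suc n) P@(_ ∷ _) X@(x ∷ _) E C inP inX inE cov far t with split-sound (nbhd x) P [] [] _ t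
  ... | Q , R , t′ , Sp = loop-sound n Q R X E C (λ r → inP (QR⊆P r)) inX inE
            (λ Mu → Sum.map₂ P⊆QR (cov Mu)) (λ c → far c ∘ Sum.map₁ QR⊆P) ex t′
    where
    open Split Sp
    QR⊆P : ∀ {u} → u ∈ Q ++ R → u ∈ P
    QR⊆P r with ∈-++⁻ Q r
    ... | inj₁ q with yes⁻ q
    ...   | inj₂ (q′ , _) = q′
    QR⊆P r | inj₂ q with no⁻ q
    ...   | inj₂ (q′ , _) = q′
    P⊆QR : ∀ {u} → u ∈ P → u ∈ Q ++ R
    P⊆QR {u} q with suc (code u) ∣? nbhd x
    ... | yes a = ∈-++⁺ˡ (yes⁺ q a)
    ... | no na = ∈-++⁺ʳ Q (no⁺ q na)
    ex : ∃ λ q → q ∈ Q × M q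
    ex with maximal (proj₁ (inX (here refl)))
    ... | inj₁ Mx = contradiction Mx (proj₂ (inX (here refl)))
    ... | inj₂ (u , Mu , a) with cov Mu
    ...   | inj₁ c = ⊥-elim (far c (inj₂ (here refl)) a)
    ...   | inj₂ q = u , yes⁺ q a , Mu

  loop-sound n [] R X E C inQ inX inE cov far (_ , () , _) t
  loop-sound n (q ∷ Q) R X E C inQ inX inE cov far ex t with M? q
  ... | no ¬Mq = loop-sound n Q R (q ∷ X) E C (inQ ∘ there)
      (λ { (here refl) → inQ (here refl) , ¬Mq ; (there r) → inX r }) inE cov′
      (λ { c (inj₁ r) → far c (inj₁ (there r)) ; c (inj₂ (here refl)) → far c (inj₁ (here refl)) ; c (inj₂ (there r)) → far c (inj₂ r) })
      (ex′ ex) (∧-conicalʳ _ _ t)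
    where
    cov′ : ∀ {u} → M u → C u ⊎ u ∈ Q ++ R
    cov′ Mu with cov Mu
    ... | inj₁ c = inj₁ c
    ... | inj₂ (here refl) = contradiction Mu ¬Mq
    ... | inj₂ (there r) = inj₂ r
    ex′ : (∃ λ p → p ∈ q ∷ Q × M p) → ∃ λ p → p ∈ Q × M p
    ex′ (_ , here refl , Mq) = contradiction Mq ¬Mq
    ex′ (p , there r , Mp) = p , r , Mp
  ... | yes Mq with split-sound (nbhd q) (Q ++ R) E [] _ (∧-conicalˡ _ _ t)
  ...   | E₁ , P , t₁ , Sp₁ with split-sound (nbhd q) X E₁ [] _ t₁
  ...     | E₂ , X₁ , t₂ , Sp₂ = search-sound n P X₁ E₂ (λ u → C u ⊎ u ≡ q)
      (λ r → inQ (there (proj₁ (P⁻ r)))) (λ r → inX (proj₁ (X⁻ r))) inE′ cov′ far′ t₂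
    where
    P⁻ : ∀ {u} → u ∈ P → u ∈ Q ++ R × ¬ Adj′ u q
    P⁻ r with Split.no⁻ Sp₁ r
    ... | inj₂ s = s
    X⁻ : ∀ {u} → u ∈ X₁ → u ∈ X × ¬ Adj′ u q
    X⁻ r with Split.no⁻ Sp₂ r
    ... | inj₂ s = s
    inE′ : ∀ {u} → u ∈ E₂ → Out u
    inE′ e with Split.yes⁻ Sp₂ e
    ... | inj₂ (r , _) = inX r
    ... | inj₁ e₁ with Split.yes⁻ Sp₁ e₁
    ...   | inj₁ e₀ = inE e₀
    ...   | inj₂ (r , a) = inQ (there r) , λ Mu → indep Mu Mq a
    cov′ : ∀ {u} → M u → (C u ⊎ u ≡ q) ⊎ u ∈ P
    cov′ Mu with cov Mu
    ... | inj₁ c = inj₁ (inj₁ c)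
    ... | inj₂ (here refl) = inj₁ (inj₂ refl)
    ... | inj₂ (there r) = inj₂ (Split.no⁺ Sp₁ r (indep Mu Mq))
    far′ : ∀ {u v} → C u ⊎ u ≡ q → v ∈ P ⊎ v ∈ X₁ → ¬ Adj′ u v
    far′ (inj₁ c) (inj₁ r) = far c (inj₁ (there (proj₁ (P⁻ r))))
    far′ (inj₁ c) (inj₂ r) = far c (inj₂ (proj₁ (X⁻ r)))
    far′ (inj₂ refl) (inj₁ r) a = proj₂ (P⁻ r) (symm (inQ (here refl)) (inQ (there (proj₁ (P⁻ r)))) a)
    far′ (inj₂ refl) (inj₂ r) a = proj₂ (X⁻ r) (symm (inQ (here refl)) (proj₁ (inX (proj₁ (X⁻ r)))) a)

  from-sound : ∀ v L → M v → S v → (∀ {u} → u ∈ L → S u) → (∀ {u} → M u → u ≡ v ⊎ u ∈ L) → from o v L ≢ true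
  from-sound v L Mv Sv inL cov t with split-sound (nbhd v) L [] [] _ t
  ... | E , P , t′ , Sp = search-sound 64 P [] E (_≡ v) (λ r → inL (proj₁ (P⁻ r))) (λ ()) inE
      (λ Mu → Sum.map₂ (λ r → Split.no⁺ Sp r (indep Mu Mv)) (cov Mu))
      (λ { refl (inj₁ r) a → proj₂ (P⁻ r) (symm Sv (inL (proj₁ (P⁻ r))) a) }) t′
    where
    P⁻ : ∀ {u} → u ∈ P → u ∈ L × ¬ Adj′ u v
    P⁻ r with Split.no⁻ Sp r
    ... | inj₂ s = s
    inE : ∀ {u} → u ∈ E → Out u
    inE r with Split.yes⁻ Sp r
    ... | inj₂ (s , a) = inL s , λ Mu → indep Mu Mv a

-- Refuting colourings.

module Colourings {A : Set} (_≟_ : DecidableEquality A) where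

  -- Colours depend on codes alone, so that one `f` colours the tables of different graphs K_J at
  -- the same time.
  record Coloured (f : ℕ → A) (cs : List A) (L : List Vertex) : Set where
    field
      range  : ∀ {u} → u ∈ L → f (code u) ∈ cs
      proper : ∀ {u v} → u ∈ L → v ∈ L → Adj′ u v → f (code u) ≢ f (code v)

  Coloured-⊆ : ∀ {f cs L L′} → (∀ {u} → u ∈ L′ → u ∈ L) → Coloured f cs L → Coloured f cs L′
  Coloured-⊆ L′⊆L c = record
    { range = range ∘ L′⊆L ; proper = λ p q → proper (L′⊆L p) (L′⊆L q) }
    where open Coloured c

  remove : ∀ {c : A} {cs} → c ∈ cs → ∃ λ cs′ → length cs ≡ suc (length cs′) × (∀ {d} → d ∈ cs → d ≢ c → d ∈ cs′)
  remove {cs = _ ∷ cs} (here refl) = cs , refl , λ { (here refl) d≢c → contradiction refl d≢c ; (there p) _ → p }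
  remove {cs = b ∷ cs} (there p) =
    let cs′ , eq , keep = remove p
    in b ∷ cs′ , cong suc eq , λ { (here refl) _ → here refl ; (there q) d≢c → there (keep q d≢c) }

  module _ (S : Vertex → Set) (symm : ∀ {u v} → S u → S v → Adj′ u v → Adj′ v u) (f : ℕ → A) where

    Refutes : ℕ → Test → Set
    Refutes k o = ∀ L → (∀ {u} → u ∈ L → S u) → o L ≡ true →
                  ∀ cs → length cs ≡ k → ¬ Coloured f cs L

    Independent : List Vertex → Set
    Independent M = ∀ {u v} → u ∈ M → v ∈ M → ¬ Adj′ u v

    -- Greedy extension: a vertex of `L` is added unless the set already contains a neighbour of it.
    -- As the set only grows, such a neighbour remains to the end.
    extend : ∀ L M → (∀ {u} → u ∈ L → S u × ¬ Adj′ u u) → (∀ {u} → u ∈ M → S u) → Independent M →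
             ∃ λ M′ → (∀ {u} → u ∈ M → u ∈ M′) × Independent M′ × (∀ {u} → u ∈ M′ → u ∈ M ⊎ u ∈ L) ×
                      (∀ {u} → u ∈ L → u ∈ M′ ⊎ ∃ λ v → v ∈ M′ × Adj′ v u)
    extend [] M inL inM ind = M , id , ind , inj₁ , λ ()
    extend (y ∷ L) M inL inM ind with Any.any? (λ v → suc (code v) ∣? nbhd y) M
    ... | yes a =
      let M′ , M⊆ , ind′ , M′⊆ , max = extend L M (inL ∘ there) inM ind
          v , p , q = find a
      in M′ , M⊆ , ind′ , Sum.map₂ there ∘ M′⊆ , λ { (here refl) → inj₂ (v , M⊆ p , q) ; (there r) → max r }
    ... | no na =
      let Sy , loopless = inL (here refl)
          new : ∀ {v} → v ∈ M → ¬ Adj′ v y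
          new p a = na (lose p a)
          M′ , M⊆ , ind′ , M′⊆ , max = extend L (y ∷ M) (inL ∘ there)
            (λ { (here refl) → Sy ; (there p) → inM p })
            (λ { (here refl) (here refl) → loopless
               ; (here refl) (there q) a → new q (symm Sy (inM q) a)
               ; (there p) (here refl) → new p
               ; (there p) (there q) → ind p q })
      in M′ , M⊆ ∘ there , ind′
       , (λ p → [ (λ { (here refl) → inj₂ (here refl) ; (there q) → inj₁ q }) , inj₂ ∘ there ]′ (M′⊆ p))
       , λ { (here refl) → inj₁ (M⊆ (here refl)) ; (there r) → max r }

    -- A colour class may be enlarged to a maximal independent set, whose complement needs one colour less.
    from-refutes : ∀ {k o} → Refutes k o → ∀ v L → (∀ {u} → u ∈ v ∷ L → S u) → from o v L ≡ true →
                   ∀ cs → length cs ≡ suc k → ¬ Coloured f cs (v ∷ L)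
    from-refutes {k} {o} R v L inL t cs len col =
      Search.from-sound (_∈ v ∷ L) (_∈ M) (_∈? M) M⊆U (λ p q → symm (inL p) (inL q)) ind max o o-sound
        v L (class⊆M (∈-filter⁺ inClass? (here refl) refl)) (here refl) there (λ p → ∈∷⁻ (M⊆U p)) t
      where
      open Coloured col
      c = f (code v)
      inClass? : ∀ u → Dec (f (code u) ≡ c)
      inClass? u = f (code u) ≟ c
      class = filter inClass? (v ∷ L)
      class⁻ : ∀ {u} → u ∈ class → u ∈ v ∷ L × f (code u) ≡ c
      class⁻ = ∈-filter⁻ inClass?
      extension = extend (v ∷ L) class (λ p → inL p , λ a → proper p p a refl) (inL ∘ proj₁ ∘ class⁻)
        λ p q a → proper (proj₁ (class⁻ p)) (proj₁ (class⁻ q)) a (trans (proj₂ (class⁻ p)) (≡-sym (proj₂ (class⁻ q))))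
      M = proj₁ extension
      class⊆M = proj₁ (proj₂ extension)
      ind = proj₁ (proj₂ (proj₂ extension))
      max = proj₂ (proj₂ (proj₂ (proj₂ extension)))
      M⊆U : ∀ {u} → u ∈ M → u ∈ v ∷ L
      M⊆U p = [ proj₁ ∘ class⁻ , id ]′ (proj₁ (proj₂ (proj₂ (proj₂ extension))) p)
      ∈∷⁻ : ∀ {u} → u ∈ v ∷ L → u ≡ v ⊎ u ∈ L
      ∈∷⁻ (here eq) = inj₁ eq
      ∈∷⁻ (there p) = inj₂ p
      o-sound : ∀ E → (∀ {u} → u ∈ E → u ∈ v ∷ L × ¬ u ∈ M) → o E ≢ true
      o-sound E inE tE =
        let cs′ , len′ , keep = remove (range (here refl))
        in R E (inL ∘ proj₁ ∘ inE) tE cs′ (ℕ.suc-injective (trans (≡-sym len′) len)) record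
          -- The colour `c` does not occur on `E`: its class lies in `M`, which `E` avoids.
          { range  = λ p → keep (range (proj₁ (inE p))) λ eq →
                       proj₂ (inE p) (class⊆M (∈-filter⁺ inClass? (proj₁ (inE p)) eq))
          ; proper = λ p q → proper (proj₁ (inE p)) (proj₁ (inE q)) }

-- Recursive tests for not being k-colourable.

weight : ℕ → List Vertex → ℕ
weight a [] = a
weight a (vx _ _ w _ ∷ L) = weight (a + w) L

-- W is the sum of the neighbourhoods in base 32, so that its digits are the degrees.  Vertices
-- of degree less than j can be coloured last; κ is applied to a vertex of maximal degree.
pick : (Vertex → Test) → ℕ → ℕ → List Vertex → Vertex → ℕ → Test
pick′ : (Vertex → Test) → ℕ → ℕ → List Vertex → Vertex → ℕ → List Vertex → Vertex → ℕ → Bool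
pick″ : (Vertex → Test) → ℕ → ℕ → List Vertex → Vertex → ℕ → List Vertex → Vertex → ℕ → Bool → Bool → Bool
pick κ W j [] b d L = κ b L
pick κ W j (u@(vx _ _ _ s) ∷ us) b d L = pick′ κ W j us b d L u (mod-helper 0 31 (div-helper 0 s W s) 31)
pick′ κ W j us b d L u e = pick″ κ W j us b d L u e (e <ᵇ j) (d <ᵇ e)
pick″ κ W j us b d L u e true  _     = pick κ W j us b d L
pick″ κ W j us b d L u e false true  = pick κ W j us u e (b ∷ L)
pick″ κ W j us b d L u e false false = pick κ W j us b d (u ∷ L)

choose : (Vertex → Test) → ℕ → ℕ → Test
choose κ W j []       = false
-- The first vertex is the provisional maximum; it enters with degree 0 and is exempt from the
-- threshold `j`.
choose κ W j (u ∷ us) = pick κ W j us u 0 []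

-- A colouring restricts to every sublist, so any choice of the vertices to drop and of the vertex
-- for `κ` is sound. The degrees only influence whether the test succeeds.
pick-sound : ∀ κ W j us b d L → pick κ W j us b d L ≡ true →
             ∃ λ v → ∃ λ L′ → κ v L′ ≡ true × (∀ {u} → u ∈ v ∷ L′ → u ∈ b ∷ L ⊎ u ∈ us)
pick-sound κ W j [] b d L t = b , L , t , inj₁
pick-sound κ W j (u@(vx _ _ _ s) ∷ us) b d L t = go degree (degree <ᵇ j) (d <ᵇ degree) t
  where
  degree = mod-helper 0 31 (div-helper 0 s W s) 31
  go : ∀ e x y → pick″ κ W j us b d L u e x y ≡ true →
       ∃ λ v → ∃ λ L′ → κ v L′ ≡ true × (∀ {x} → x ∈ v ∷ L′ → x ∈ b ∷ L ⊎ x ∈ u ∷ us)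
  go e true y t =
    let v , L′ , t′ , sub = pick-sound κ W j us b d L t
    in v , L′ , t′ , Sum.map₂ there ∘ sub
  go e false true t =
    let v , L′ , t′ , sub = pick-sound κ W j us u e (b ∷ L) t
    in v , L′ , t′ , λ p → [ (λ { (here eq) → inj₂ (here eq) ; (there q) → inj₁ q }) , inj₂ ∘ there ]′ (sub p)
  go e false false t =
    let v , L′ , t′ , sub = pick-sound κ W j us b d (u ∷ L) t
    in v , L′ , t′ , λ p → [ (λ { (here eq) → inj₁ (here eq) ; (there (here eq)) → inj₂ (here eq) ; (there (there q)) → inj₁ (there q) })
                           , inj₂ ∘ there ]′ (sub p)

choose-sound : ∀ κ W j L → choose κ W j L ≡ true →
               ∃ λ v → ∃ λ L′ → κ v L′ ≡ true × (∀ {u} → u ∈ v ∷ L′ → u ∈ L)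
choose-sound κ W j (b ∷ us) t =
  let v , L′ , t′ , sub = pick-sound κ W j us b 0 [] t
  in v , L′ , t′ , λ p → [ (λ { (here eq) → here eq }) , there ]′ (sub p)

-- Breadth-first search for an odd cycle, with layers F of one colour: a prime divides nbhds 1 F
-- iff its vertex has a neighbour in F.
nbhds : ℕ → List Vertex → ℕ
nbhds g [] = g
nbhds g (vx _ nb _ _ ∷ F) = nbhds (nb * g) F

bip : ℕ → List Vertex → Test
inner : List Vertex → ℕ → ℕ → Test
inner′ : ℕ → List Vertex → ℕ → ℕ → Test
bip zero F R = false
bip (suc n) [] [] = false
bip (suc n) [] (r ∷ R) = split (nbhd r) R [] [] (bip n)
bip (suc n) F@(_ ∷ _) R = inner F (nbhds 1 F) n R
inner [] g n R = split g R [] [] (bip n)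
inner (vx m _ _ _ ∷ F) g n R = inner′ (mod-helper 0 m g m) F g n R
inner′ zero    F g n R = true
inner′ (suc _) F g n R = inner F g n R

test : ℕ → Test
-- Each step of `bip` uses up a vertex, and every block has fewer than 64.
test zero L = bip 64 [] L
-- `test (suc j)` is to refute j + 3 colours, hence this threshold for the degrees.
test (suc j) L = choose (from (test j)) (weight 0 L) (suc (suc (suc j))) L

-- By Euclid's lemma multiplying neighbourhoods amounts to forming their union; repeated factors do
-- no harm.
nbhds-∣ : ∀ {p} → Prime p → ∀ g F → p ∣ nbhds g F → p ∣ g ⊎ Any (λ v → p ∣ nbhd v) F
nbhds-∣ pr g [] d = inj₁ d
nbhds-∣ pr g (vx _ nb _ _ ∷ F) d with nbhds-∣ pr (nb * g) F d
... | inj₂ a = inj₂ (there a)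
... | inj₁ d′ = [ inj₂ ∘ here , inj₁ ]′ (euclidsLemma nb g pr d′)

module Tests {A : Set} (_≟_ : DecidableEquality A) (S : Vertex → Set)
  (symm : ∀ {u v} → S u → S v → Adj′ u v → Adj′ v u) (prime : ∀ {u} → S u → Prime (suc (code u)))
  (f : ℕ → A) where

  open Colourings _≟_

  Two : A → A → Vertex → Set
  Two c d u = f (code u) ≡ c ⊎ f (code u) ≡ d

  Proper : List Vertex → List Vertex → Set
  Proper F R = ∀ {u v} → u ∈ F ⊎ u ∈ R → v ∈ F ⊎ v ∈ R → Adj′ u v → f (code u) ≢ f (code v)

  -- If the layer `F` has colour `c`, its neighbours in `R` have colour `d` and form the next layer,
  -- with the roles of `c` and `d` exchanged. An edge inside a layer is a contradiction. The first
  -- vertex of a component may have either colour.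
  bip-sound : ∀ n F R c d → (∀ {u} → u ∈ F → S u × f (code u) ≡ c) → (∀ {u} → u ∈ R → S u × Two c d u) →
              Proper F R → bip n F R ≢ true
  next-sound : ∀ n g R c d → (∀ {u} → u ∈ R → S u × Two c d u) → Proper [] R →
               (∀ {u} → u ∈ R → u ∈ₛ g → f (code u) ≢ c) → split g R [] [] (bip n) ≢ true
  next-sound n g R c d inR proper nb t with split-sound g R [] [] (bip n) t
  ... | Y , N , t′ , Sp = bip-sound n Y N d c
      (λ p → proj₁ (inR (proj₁ (Y⁻ p))) , [ (λ eq → contradiction eq (nb (proj₁ (Y⁻ p)) (proj₂ (Y⁻ p)))) , id ]′ (proj₂ (inR (proj₁ (Y⁻ p)))))
      (λ p → proj₁ (inR (N⁻ p)) , Sum.swap (proj₂ (inR (N⁻ p))))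
      (λ p q → proper (inj₂ (sub p)) (inj₂ (sub q))) t′
    where
    open Split Sp
    Y⁻ : ∀ {u} → u ∈ Y → u ∈ R × u ∈ₛ g
    Y⁻ p with yes⁻ p
    ... | inj₂ q = q
    N⁻ : ∀ {u} → u ∈ N → u ∈ R
    N⁻ p with no⁻ p
    ... | inj₂ (q , _) = q
    sub : ∀ {u} → u ∈ Y ⊎ u ∈ N → u ∈ R
    sub (inj₁ p) = proj₁ (Y⁻ p)
    sub (inj₂ p) = N⁻ p
  inner-sound : ∀ n F g R c d → (∀ {u} → u ∈ F → f (code u) ≡ c) → (∀ {u} → u ∈ F → u ∈ₛ g → f (code u) ≢ c) →
                (∀ {u} → u ∈ R → S u × Two c d u) → Proper [] R →
                (∀ {u} → u ∈ R → u ∈ₛ g → f (code u) ≢ c) → inner F g n R ≢ true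
  inner-sound n [] g R c d inF nbF inR proper nb t = next-sound n g R c d inR proper nb t
  inner-sound n (vx m _ _ _ ∷ F) g R c d inF nbF inR proper nb t with mod-helper 0 m g m in eq
  ... | zero  = nbF (here refl) (m%n≡0⇒n∣m g (suc m) eq) (inF (here refl))
  ... | suc _ = inner-sound n F g R c d (inF ∘ there) (nbF ∘ there) inR proper nb t
  bip-sound (suc n) [] (r ∷ R) c d inF inR proper t with inR (here refl)
  ... | Sr , inj₁ eq = next-sound n (nbhd r) R c d (inR ∘ there) (λ p q → proper (Sum.map₂ there p) (Sum.map₂ there q))
        (λ p a e → proper (inj₂ (there p)) (inj₂ (here refl)) a (trans e (≡-sym eq))) t
  ... | Sr , inj₂ eq = next-sound n (nbhd r) R d c (λ p → proj₁ (inR (there p)) , Sum.swap (proj₂ (inR (there p))))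
        (λ p q → proper (Sum.map₂ there p) (Sum.map₂ there q))
        (λ p a e → proper (inj₂ (there p)) (inj₂ (here refl)) a (trans e (≡-sym eq))) t
  bip-sound (suc n) F@(_ ∷ _) R c d inF inR proper t =
    inner-sound n F (nbhds 1 F) R c d (proj₂ ∘ inF)
      (λ p → nb (proj₁ (inF p)) (inj₁ p)) inR
      (λ p q → proper (Sum.map₁ (λ ()) p) (Sum.map₁ (λ ()) q)) (λ p → nb (proj₁ (inR p)) (inj₂ p)) t
    where
    nb : ∀ {u} → S u → u ∈ F ⊎ u ∈ R → u ∈ₛ nbhds 1 F → f (code u) ≢ c
    nb Su p a e with nbhds-∣ (prime Su) 1 F a
    ... | inj₁ p∣1 = ¬prime[1] (subst Prime (∣1⇒≡1 p∣1) (prime Su))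
    ... | inj₂ w = let v , q , a′ = find w in proper p (inj₁ q) a′ (trans e (≡-sym (proj₂ (inF q))))

  test-refutes : ∀ j → Refutes S symm f (suc (suc j)) (test j)
  test-refutes zero L inL t (c ∷ d ∷ []) refl col = bip-sound 64 [] L c d (λ ())
    (λ p → inL p , two (range p)) (λ { (inj₂ p) (inj₂ q) → proper p q }) t
    where
    open Coloured col
    two : ∀ {a} → a ∈ c ∷ d ∷ [] → a ≡ c ⊎ a ≡ d
    two (here eq) = inj₁ eq
    two (there (here eq)) = inj₂ eq
  test-refutes (suc j) L inL t cs len col with choose-sound _ _ _ L t
  ... | v , L′ , t′ , sub = from-refutes S symm f (test-refutes j) v L′ (inL ∘ sub) t′ cs len (Coloured-⊆ sub col)

-- The product of the primes of L is suc (product L).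
product : List Vertex → ℕ
product [] = 0
product (vx m _ _ _ ∷ L) = m + product L * suc m

∈⇒∣product : ∀ {u L} → u ∈ L → u ∈ₛ suc (product L)
∈⇒∣product {u@(vx m _ _ _)} {_ ∷ L} (here refl) = n∣m*n (suc (product L))
∈⇒∣product {u} {vx m _ _ _ ∷ L} (there p) = ∣-trans (∈⇒∣product p) (m∣m*n (suc m))

-- Euclid's lemma singles out a factor, and irreducibility makes it equal to `p`. Only the code is
-- identified, as the same vertex has different neighbourhoods in different graphs K_J.
∣product⇒∈ : ∀ {p} L → Prime p → (∀ {u} → u ∈ L → Prime (suc (code u))) → p ∣ suc (product L) →
             ∃ λ u → u ∈ L × p ≡ suc (code u)
∣product⇒∈ [] pr prL p∣1 = contradiction (subst Prime (∣1⇒≡1 p∣1) pr) ¬prime[1]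
∣product⇒∈ (u@(vx m _ _ _) ∷ L) pr prL d with euclidsLemma (suc (product L)) (suc m) pr d
... | inj₁ d′ = let v , q , eq = ∣product⇒∈ L pr (prL ∘ there) d′ in v , there q , eq
... | inj₂ d′ with prime⇒irreducible (prL (here refl)) d′
...   | inj₁ eq = contradiction (subst Prime eq pr) ¬prime[1]
...   | inj₂ eq = u , here refl , eq

contains : List ℕ → ℕ → Bool
contains′ : ℕ → List ℕ → ℕ → Bool
contains [] r = false
contains (c ∷ cs) r = contains′ (mod-helper 0 c r c) cs r
contains′ zero    cs r = true
contains′ (suc _) cs r = contains cs r

contains-sound : ∀ cs r → contains cs r ≡ true → ∃ λ c → c ∈ cs × suc c ∣ r
contains-sound (c ∷ cs) r t with mod-helper 0 c r c in eq
... | zero  = c , here refl , m%n≡0⇒n∣m r (suc c) eq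
... | suc _ = let c′ , p , d = contains-sound cs r t in c′ , there p , d

-- If the product of a set divides that of `E`, the set is contained in `E` as far as codes go, so
-- each listed set costs one remainder.
known : List ℕ → Test
known cs E = contains cs (suc (product E))

-- Boolean checks and the format of the certificates.

dividesᵇ : ℕ → ℕ → Bool
dividesᵇ m g = mod-helper 0 m g m ≡ᵇ 0

memᵇ : ℕ → List ℕ → Bool
memᵇ i = any (i ≡ᵇ_)

all-lookup : ∀ {A : Set} (p : A → Bool) xs → all p xs ≡ true → ∀ {x} → x ∈ xs → p x ≡ true
all-lookup p (x ∷ xs) t (here refl) = ∧-conicalˡ _ _ t
all-lookup p (x ∷ xs) t (there q) = all-lookup p xs (∧-conicalʳ (p x) _ t) q

any-find : ∀ {A : Set} (p : A → Bool) xs → any p xs ≡ true → ∃ λ x → x ∈ xs × p x ≡ true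
any-find p (x ∷ xs) t with p x in eq
... | true  = x , here refl , eq
... | false = let y , q , e = any-find p xs t in y , there q , e

memᵇ⇒∈ : ∀ i xs → memᵇ i xs ≡ true → i ∈ xs
memᵇ⇒∈ i xs t =
  let j , p , e = any-find (i ≡ᵇ_) xs t
  in subst (_∈ xs) (≡-sym (ℕ.≡ᵇ⇒≡ i j (Equivalence.from T-≡ e))) p

∈⇒memᵇ : ∀ {i xs} → i ∈ xs → memᵇ i xs ≡ true
∈⇒memᵇ {i} {_ ∷ xs} (here refl) rewrite Equivalence.to T-≡ (ℕ.≡⇒≡ᵇ i i refl) = refl
∈⇒memᵇ {i} {x ∷ xs} (there p) rewrite ∈⇒memᵇ p = Bool.∨-zeroʳ (i ≡ᵇ x)

∨-elim : ∀ x {y} → x ∨ y ≡ true → x ≡ true ⊎ y ≡ true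
∨-elim true  t = inj₁ t
∨-elim false t = inj₂ t

not-elim : ∀ {x} → not x ≡ true → x ≢ true
not-elim {false} _ ()

infixr 3 _⇒ᵇ_
_⇒ᵇ_ : Bool → Bool → Bool
true  ⇒ᵇ y = y
false ⇒ᵇ y = true

⇒ᵇ-elim : ∀ {x y} → (x ⇒ᵇ y) ≡ true → x ≡ true → y ≡ true
⇒ᵇ-elim t refl = t

position : ℕ → List ℕ → ℕ → ℕ
position m [] i = i
position m (x ∷ xs) i = if m ≡ᵇ x then i else position m xs (suc i)

-- The lowest bit belongs to the head of the list, so a mask refers to the order of the vertices in
-- its block.
subset : ℕ → List Vertex → List Vertex
subset′ : ℕ → ℕ → Vertex → List Vertex → List Vertex
subset c [] = []
subset c (u ∷ L) = subset′ (mod-helper 0 1 c 1) (div-helper 0 1 c 1) u L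
subset′ zero    c u L = subset c L
subset′ (suc _) c u L = u ∷ subset c L

subset-⊆ : ∀ c L {u} → u ∈ subset c L → u ∈ L
subset-⊆ c (v ∷ L) p with mod-helper 0 1 c 1
... | zero = there (subset-⊆ _ L p)
subset-⊆ c (v ∷ L) (here refl) | suc _ = here refl
subset-⊆ c (v ∷ L) (there p) | suc _ = there (subset-⊆ _ L p)

-- A block describes K_J on the vertices is, together with vertex sets that are not
-- 4-colourable, given by their characteristic functions in base 2.
record Block : Set where
  constructor block
  field
    J is masks : List ℕ

-- `own` is the graph to be shown not 5-colourable; the sets that are not 4-colourable may be taken
-- from several graphs.
record Certificate : Set where
  constructor certificate
  field
    own     : Block
    sources : List Block

setsOf : List ℕ → List Vertex → List (List Vertex)
setsOf masks L = map (λ c → subset c L) masks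

adjᵛ : Vertex → Vertex → Bool
adjᵛ (vx m _ _ _) (vx _ nb _ _) = dividesᵇ m nb

adjᵛ⇒Adj : ∀ u v → adjᵛ u v ≡ true → Adj′ u v
adjᵛ⇒Adj (vx m _ _ _) (vx _ nb _ _) t = m%n≡0⇒n∣m nb (suc m) (ℕ.≡ᵇ⇒≡ _ 0 (Equivalence.from T-≡ t))

Adj⇒adjᵛ : ∀ u v → Adj′ u v → adjᵛ u v ≡ true
Adj⇒adjᵛ (vx m _ _ _) (vx _ nb _ _) d rewrite n∣m⇒m%n≡0 nb (suc m) d = refl

-- The fixed vertex, whose colour class is enlarged, is the first one listed in the block.
start : Test → Test
start o []      = false
start o (v ∷ L) = from o v L

sublists : List ℕ → List (List ℕ)
sublists []       = [] ∷ []
sublists (d ∷ ds) = map (d ∷_) (sublists ds) ++ sublists ds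

filter∈sublists : ∀ {P : ℕ → Set} (P? : ∀ d → Dec (P d)) ds → filter P? ds ∈ sublists ds
filter∈sublists P? [] = here refl
filter∈sublists P? (d ∷ ds) with P? d
... | yes _ = ∈-++⁺ˡ (∈-map⁺ (d ∷_) (filter∈sublists P? ds))
... | no _  = ∈-++⁺ʳ (map (d ∷_) (sublists ds)) (filter∈sublists P? ds)

-- The graphs K_J.

module KGraphs (labels : List ℕ) (label row cover : ℕ → ℕ) (D : List ℕ) where

  index : ℕ → ℕ
  index m = position m labels 0

  -- The bounds keep out the default 0 of the tables: the row 0 is divisible by every prime, and the
  -- label 0 stands for 1, which divides every row.
  adjᵇ : ℕ → ℕ → Bool
  adjᵇ i j = (i <ᵇ 77) ∧ (j <ᵇ 77) ∧ dividesᵇ (label i) (row j)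

  -- If J consists of the vertices in D with the colour of the apex, then hard vertices do not have it.
  hard : List ℕ → ℕ → Bool
  hard J i = memᵇ i D ∧ not (memᵇ i J) ∨ any (adjᵇ i) J

  table : List ℕ → List ℕ → List Vertex
  table J is = map vertex entries
    where
    entries = map (λ i → i , label i , row i , 32 ^ i) is
    kept : ℕ → ℕ → Bool
    -- Numbers from 42 on stand for copies; an edge at a copy is kept only if its other end is never
    -- recoloured.
    kept i j = ((i <ᵇ 42) ∨ hard J j) ∧ ((j <ᵇ 42) ∨ hard J i)
    collect : List (ℕ × ℕ × ℕ × ℕ) → ℕ → ℕ → ℕ → ℕ → ℕ → ℕ → Vertex
    collect [] i m r e g w = vx m g w (e ∸ 1)
    collect ((j , l , _ , e′) ∷ js) i m r e g w =
      if dividesᵇ l r ∧ kept i j then collect js i m r e (suc l * g) (e′ + w) else collect js i m r e g w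
    vertex : ℕ × ℕ × ℕ × ℕ → Vertex
    vertex (i , m , r , e) = collect entries i m r e 1 0

  vertices : Block → List Vertex
  vertices (block J is masks) = table J is

  sets : Block → List (List Vertex)
  sets (block J is masks) = setsOf masks (table J is)

  okTable : List Vertex → Bool
  okTable L = all (λ u → memᵇ (code u) labels ∧ all (λ v → adjᵛ u v ⇒ᵇ adjᵛ v u) L) L

  okBlock : Block → Bool
  okBlock b = okTable (vertices b) ∧ all (test 2) (sets b)

  safe : List ℕ → ℕ → Bool
  safe J i = adjᵇ i 76 ∨ hard J i

  -- The edge survives a recolouring of `i`: either the new colour is that of a neighbour of `j`, or
  -- `i` cannot have the colour of the apex. A recolouring of `j` is dealt with by the reversed
  -- pair.
  okEdge : List ℕ → ℕ → ℕ → Bool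
  okEdge J i j = adjᵇ i j ∧ (adjᵇ (cover i) j ∨ safe J i)

  -- This ensures that only five colours remain: a recoloured vertex takes its colour from a
  -- neighbour of the apex.
  okVertex : List ℕ → ℕ → Bool
  okVertex J i = not (memᵇ i J) ∧ (adjᵇ (cover i) 76 ∨ safe J i)

  -- A source block may contain vertices of `J`, but the sets used from it lie inside `own` and so
  -- avoid `J`; edges at `J` are therefore exempt.
  okPair : List ℕ → ℕ × Vertex → ℕ × Vertex → Bool
  okPair J (i , u) (j , v) = adjᵛ u v ⇒ᵇ (memᵇ i J ∨ memᵇ j J ∨ okEdge J i j)

  tag : Vertex → ℕ × Vertex
  tag u = index (code u) , u

  indexed : List Vertex → List (ℕ × Vertex)
  indexed = map tag

  compatible : List ℕ → List (ℕ × Vertex) → Bool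
  compatible J L = all (λ u → all (okPair J u) L) L

  okLevel : List ℕ → List Vertex → List Block → Bool
  okLevel J L bs = compatible J (indexed L) ∧ all (λ u → okVertex J (index (code u))) L ∧
    all (λ b → compatible J (indexed (vertices b))) bs ∧ start (known (map product (concatMap sets bs))) L

  okCertificate : Certificate → Bool
  okCertificate (certificate b bs) = okLevel (Block.J b) (vertices b) bs

  hasEdge : List ℕ → Bool
  hasEdge J = any (λ i → any (adjᵇ i) J) J

  -- A set that meets both triples contains an edge and cannot be monochromatic, which settles 49 of
  -- the 64 subsets of `D`.
  covered : List Certificate → List ℕ → Bool
  covered cs J = hasEdge J ∨ any (λ c → ⌊ ≡-dec ℕ._≟_ (Block.J (Certificate.own c)) J ⌋) cs

  -- As a record rather than a bare equation this is a type that mentions only the block, so that a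
  -- block shared by several certificates is evaluated once.
  record ValidBlock (b : Block) : Set where
    constructor valid
    field check : okBlock b ≡ true

  record ValidCertificate (c : Certificate) : Set where
    constructor validCertificate
    open Certificate c
    field
      own-valid     : ValidBlock own
      sources-valid : All ValidBlock sources
      check         : okCertificate c ≡ true

  -- From a 6-colouring of H to 5-colourings of the graphs K_J.

  module Soundness
    (prime : ∀ {m} → m ∈ labels → Prime (suc m))
    (φ : ℕ → Fin 6) (φ-proper : ∀ i j → adjᵇ i j ≡ true → φ i ≢ φ j)
    where

    module _ (L : List Vertex) (ok : okTable L ≡ true) where

      table-prime : ∀ {u} → u ∈ L → Prime (suc (code u))
      table-prime {u} p = prime (memᵇ⇒∈ (code u) labels (∧-conicalˡ _ _ (all-lookup _ L ok p)))

      table-sym : ∀ {u v} → u ∈ L → v ∈ L → Adj′ u v → Adj′ v u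
      table-sym {u} {v} p q a = adjᵛ⇒Adj v u (⇒ᵇ-elim
        (all-lookup _ L (∧-conicalʳ (memᵇ (code u) labels) _ (all-lookup _ L ok p)) q) (Adj⇒adjᵛ u v a))

    c₀ : Fin 6
    c₀ = φ 76

    others : List (Fin 6)
    others = filter (λ c → ¬? (c Fin.≟ c₀)) (allFin 6)

    length-others : length others ≡ 5
    length-others = go c₀
      where
      go : ∀ c₁ → length (filter (λ c → ¬? (c Fin.≟ c₁)) (allFin 6)) ≡ 5
      go zero = refl
      go (suc zero) = refl
      go (suc (suc zero)) = refl
      go (suc (suc (suc zero))) = refl
      go (suc (suc (suc (suc zero)))) = refl
      go (suc (suc (suc (suc (suc zero))))) = refl

    -- Vertices coloured like the apex take the colour of their copy.
    χ : ℕ → Fin 6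
    χ i with φ i Fin.≟ c₀
    ... | yes _ = φ (cover i)
    ... | no  _ = φ i

    f : ℕ → Fin 6
    f m = χ (index m)

    module _ (J : List ℕ) (J⁻ : ∀ {d} → d ∈ J → φ d ≡ c₀) (J⁺ : ∀ {d} → d ∈ D → φ d ≡ c₀ → d ∈ J) where

      safe-sound : ∀ i → safe J i ≡ true → φ i ≢ c₀
      safe-sound i t eq with ∨-elim (adjᵇ i 76) t
      ... | inj₁ a = φ-proper i 76 a eq
      ... | inj₂ h with ∨-elim (memᵇ i D ∧ not (memᵇ i J)) h
      ...   | inj₁ d = not-elim (∧-conicalʳ (memᵇ i D) _ d) (∈⇒memᵇ (J⁺ (memᵇ⇒∈ i D (∧-conicalˡ _ _ d)) eq))
      ...   | inj₂ a = let d , p , e = any-find (adjᵇ i) J a in φ-proper i d e (trans eq (≡-sym (J⁻ p)))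

      -- Adjacent vertices are never both recoloured, since both would have had the colour of the
      -- apex. If one of them is, its cover is adjacent to the other.
      χ-edge : ∀ i j → okEdge J i j ≡ true → okEdge J j i ≡ true → χ i ≢ χ j
      χ-edge i j ij ji with φ i Fin.≟ c₀ | φ j Fin.≟ c₀
      ... | no _  | no _  = φ-proper i j (∧-conicalˡ _ _ ij)
      ... | yes p | yes q = λ _ → φ-proper i j (∧-conicalˡ _ _ ij) (trans p (≡-sym q))
      ... | yes p | no _  with ∨-elim (adjᵇ (cover i) j) (∧-conicalʳ (adjᵇ i j) _ ij)
      ...   | inj₁ a = φ-proper (cover i) j a
      ...   | inj₂ s = contradiction p (safe-sound i s)
      χ-edge i j ij ji | no _ | yes q with ∨-elim (adjᵇ (cover j) i) (∧-conicalʳ (adjᵇ j i) _ ji)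
      ...   | inj₁ a = φ-proper (cover j) i a ∘ ≡-sym
      ...   | inj₂ s = contradiction q (safe-sound j s)

      χ-vertex : ∀ i → okVertex J i ≡ true → χ i ≢ c₀
      χ-vertex i t with φ i Fin.≟ c₀
      ... | no ne = ne
      ... | yes p with ∨-elim (adjᵇ (cover i) 76) (∧-conicalʳ (not (memᵇ i J)) _ t)
      ...   | inj₁ a = φ-proper (cover i) 76 a
      ...   | inj₂ s = contradiction p (safe-sound i s)

      Outside : Vertex → Set
      Outside u = memᵇ (index (code u)) J ≢ true

      f-proper : ∀ L → okTable L ≡ true → compatible J (indexed L) ≡ true → ∀ {u v} → u ∈ L → v ∈ L →
                 Outside u → Outside v → Adj′ u v → f (code u) ≢ f (code v)
      f-proper L ok comp {u} {v} p q ou ov a =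
        χ-edge (index (code u)) (index (code v)) (edge p q ou ov a) (edge q p ov ou (table-sym L ok p q a))
        where
        edge : ∀ {u v} → u ∈ L → v ∈ L → Outside u → Outside v → Adj′ u v → okEdge J (index (code u)) (index (code v)) ≡ true
        edge {u} {v} p q ou ov a =
          [ (λ m → contradiction m ou) , [ (λ m → contradiction m ov) , id ]′ ∘ ∨-elim (memᵇ (index (code v)) J) ]′
          (∨-elim (memᵇ (index (code u)) J)
            (⇒ᵇ-elim (all-lookup (okPair J (tag u)) (indexed L)
              (all-lookup (λ x → all (okPair J x) (indexed L)) (indexed L) comp (∈-map⁺ tag p)) (∈-map⁺ tag q)) (Adj⇒adjᵛ u v a)))

      open Colourings (Fin._≟_ {6})

      -- `f` is a colouring of `L` with the five colours other than `c₀`. On the complement of a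
      -- maximal independent set that contains a colour class four colours remain; there a listed
      -- set would be 4-coloured, contrary to `test 2` in the graph of its block.
      level-sound : ∀ L bs → okTable L ≡ true → All ValidBlock bs →
                    okLevel J L bs ≢ true
      level-sound L bs ok oks t = refute L (∧-conicalʳ _ _ t₃) id
        where
        t₂ = ∧-conicalʳ (compatible J (indexed L)) _ t
        t₃ = ∧-conicalʳ (all (λ u → okVertex J (index (code u))) L) _ t₂
        vertex-ok : ∀ {u} → u ∈ L → okVertex J (index (code u)) ≡ true
        vertex-ok = all-lookup _ L (∧-conicalˡ _ _ t₂)
        outside : ∀ {u} → u ∈ L → Outside u
        outside p = not-elim (∧-conicalˡ _ _ (vertex-ok p))
        coloured : Coloured f others L
        coloured = record
          { range  = λ {u} p → ∈-filter⁺ (λ c → ¬? (c Fin.≟ c₀)) (∈-allFin (f (code u))) (χ-vertex (index (code u)) (vertex-ok p))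
          ; proper = λ p q → f-proper L ok (∧-conicalˡ _ _ t) p q (outside p) (outside q) }
        known-refutes : Refutes (_∈ L) (table-sym L ok) f 4 (known (map product (concatMap sets bs)))
        known-refutes E inE tE cs len col =
          let c , c∈ , c∣E = contains-sound _ _ tE
              U , U∈ , c≡ = ∈-map⁻ product c∈
              b , b∈ , U∈b = find (∈-concatMap⁻ sets {xs = bs} U∈)
              T = vertices b
              okb = ValidBlock.check (All.lookup oks b∈)
              okT = ∧-conicalˡ _ _ okb
              mask , _ , U≡ = ∈-map⁻ (λ c → subset c T) U∈b
              U⊆T : ∀ {u} → u ∈ U → u ∈ T
              U⊆T p = subset-⊆ mask T (subst (_ ∈_) U≡ p)
              -- Each vertex of `U` has a counterpart in `E` with the same code, hence with the same
              -- colour and also outside `J`.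
              match : ∀ {u} → u ∈ U → ∃ λ e → e ∈ E × code u ≡ code e
              match p =
                let e , e∈ , eq = ∣product⇒∈ E (table-prime T okT (U⊆T p)) (table-prime L ok ∘ inE)
                                    (∣-trans (∈⇒∣product p) (subst (λ x → suc x ∣ suc (product E)) c≡ c∣E))
                in e , e∈ , ℕ.suc-injective eq
              outsideU : ∀ {u} → u ∈ U → Outside u
              outsideU p = let e , e∈ , eq = match p in subst (λ m → memᵇ (index m) J ≢ true) (≡-sym eq) (outside (inE e∈))
          in Tests.test-refutes (Fin._≟_ {6}) (_∈ T) (table-sym T okT) (table-prime T okT) f 2 U U⊆T
               (all-lookup (test 2) (sets b) (∧-conicalʳ (okTable T) _ okb) U∈b) cs len record
               { range  = λ p → let e , e∈ , eq = match p in subst (λ m → f m ∈ cs) (≡-sym eq) (Coloured.range col e∈)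
               ; proper = λ p q → f-proper T okT (all-lookup _ bs (∧-conicalˡ _ _ t₃) b∈) (U⊆T p) (U⊆T q) (outsideU p) (outsideU q) }
        refute : ∀ K → start (known (map product (concatMap sets bs))) K ≡ true → (∀ {u} → u ∈ K → u ∈ L) → ⊥
        refute (v ∷ K) tK K⊆L = from-refutes (_∈ L) (table-sym L ok) f known-refutes v K K⊆L tK
          others length-others (Coloured-⊆ K⊆L coloured)

    not-colourable : ∀ cs → All ValidCertificate cs → all (covered cs) (sublists D) ≡ true → ⊥
    not-colourable cs oks cov =
      [ edge-case , certificate-case ]′ (∨-elim (hasEdge J) (all-lookup (covered cs) (sublists D) cov (filter∈sublists P? D)))
      where
      P? : ∀ d → Dec (φ d ≡ c₀)
      P? d = φ d Fin.≟ c₀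
      J = filter P? D
      J⁻ : ∀ {d} → d ∈ J → φ d ≡ c₀
      J⁻ p = proj₂ (∈-filter⁻ P? {xs = D} p)
      edge-case : hasEdge J ≢ true
      edge-case e =
        let i , i∈ , e′ = any-find (λ i → any (adjᵇ i) J) J e
            j , j∈ , ij = any-find (adjᵇ i) J e′
        in φ-proper i j ij (trans (J⁻ i∈) (≡-sym (J⁻ j∈)))
      certificate-case : any (λ c → ⌊ ≡-dec ℕ._≟_ (Block.J (Certificate.own c)) J ⌋) cs ≢ true
      certificate-case m =
        let c , c∈ , eq = any-find (λ c → ⌊ ≡-dec ℕ._≟_ (Block.J (Certificate.own c)) J ⌋) cs m
            validCertificate own-valid sources-valid check = All.lookup oks c∈
            J≡ = toWitness (Equivalence.from T-≡ eq)
        in level-sound (Block.J (Certificate.own c)) (λ d∈ → J⁻ (subst (_ ∈_) J≡ d∈))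
             (λ d∈ p → subst (_ ∈_) (≡-sym J≡) (∈-filter⁺ P? d∈ p))
             (vertices (Certificate.own c)) (Certificate.sources c)
             (∧-conicalˡ _ _ (ValidBlock.check own-valid)) sources-valid check

-- The vertices 0 to 39 form G, which was found by simulated annealing; 40 and 41 are z₁ and z₂,
-- 42 to 75 are the copies, and 76 is the apex.  Data are listed in tens.  A label is a prime
-- minus one, a row is the product of the primes of the neighbours, and the cover of a vertex
-- below 42 outside D is a copy that is joined to all its neighbours below 42.
labelTable : List (List ℕ)
labelTable =
    (1 ∷ 2 ∷ 4 ∷ 6 ∷ 10 ∷ 12 ∷ 16 ∷ 18 ∷ 22 ∷ 28 ∷ [])
  ∷ (30 ∷ 36 ∷ 40 ∷ 42 ∷ 46 ∷ 52 ∷ 58 ∷ 60 ∷ 66 ∷ 70 ∷ [])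
  ∷ (72 ∷ 78 ∷ 82 ∷ 88 ∷ 96 ∷ 100 ∷ 102 ∷ 106 ∷ 108 ∷ 112 ∷ [])
  ∷ (126 ∷ 130 ∷ 136 ∷ 138 ∷ 148 ∷ 150 ∷ 156 ∷ 162 ∷ 166 ∷ 172 ∷ [])
  ∷ (178 ∷ 180 ∷ 190 ∷ 192 ∷ 196 ∷ 198 ∷ 210 ∷ 222 ∷ 226 ∷ 228 ∷ [])
  ∷ (232 ∷ 238 ∷ 240 ∷ 250 ∷ 256 ∷ 262 ∷ 268 ∷ 270 ∷ 276 ∷ 280 ∷ [])
  ∷ (282 ∷ 292 ∷ 306 ∷ 310 ∷ 312 ∷ 316 ∷ 330 ∷ 336 ∷ 346 ∷ 348 ∷ [])
  ∷ (352 ∷ 358 ∷ 366 ∷ 372 ∷ 378 ∷ 382 ∷ 388 ∷ []) ∷ []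

rows : List (List ℕ)
rows =
    (3427797943981670795814001969390215989992900019 ∷ 230366090519562578204226743583292001009
   ∷ 1354332453902318922014190950959245070160820883 ∷ 4359254240639089560818055250290308192501695
   ∷ 132586764760066767783594081906862634999220519 ∷ 8045489379358739228591623437771329423618148705
   ∷ 5288074572101130400697400997532778323188290 ∷ 4913825396220189577870577898336494855529384581
   ∷ 82219091650093026572533186007012515 ∷ 70419471929496841411542141289809469831881 ∷ [])
  ∷ (85261924694547448714029694317221851559 ∷ 61515715830025109941949584614588965992029
   ∷ 514133986899329265090363393343354897234 ∷ 840832421617211584041097046504306271743
   ∷ 725721065430186001403420989055346630539086 ∷ 40605100206920115808493287928283131930
   ∷ 38743042364538878803147147056378714877937 ∷ 67735533755949174077976361758780971610
   ∷ 147265794408081637694490409331845819981 ∷ 2254361344468121197093041418724390895795497625517 ∷ [])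
  ∷ (24536324663790545042878795087657551919367 ∷ 1218020797053861066316415349854759532749189
   ∷ 175170950285952085876209269145115727 ∷ 103215528931923981938602711359612443546683277
   ∷ 14399183958110345729479201407803066978 ∷ 56603788864140059863676375270080356605
   ∷ 373959056514519139808493979427740665 ∷ 557371962238738356163150275079501
   ∷ 686869180361525785174426977094740364938368517 ∷ 28028029562066256726325459846733530 ∷ [])
  ∷ (224763308662768338918351010136233864484365854521 ∷ 232703734087482537364793053075067738
   ∷ 2145006486290873425837929522704306587918 ∷ 221115690542589532974995316462095745945486941
   ∷ 345546743756676947953455975855085942590 ∷ 644397181019061803966736301880004195
   ∷ 61607382519667231274828220627279510 ∷ 12487151065077140883544681920783250853
   ∷ 189164575926744028216376236826620807186649 ∷ 8807048154187346412646532746640936580498930036856099 ∷ [])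
  ∷ (4097042673710152937256564307886075960919054286049239931
   ∷ 5089141033292516412375536754288253666089831926930659928639 ∷ 34315669643216498633371013
   ∷ 444292807620986630084207 ∷ 33631941630107419472180489 ∷ 137328705519688829618135 ∷ 2245600398112454855891019
   ∷ 1227979652487881901980235 ∷ 263820530602886676184830 ∷ 103597423103635418377420091 ∷ [])
  ∷ (47849127875447222194765 ∷ 129597827469915291984211 ∷ 406539065781516480318807 ∷ 8825515496689016251126
   ∷ 8036311128947324672053 ∷ 27982122174559758173878 ∷ 393693927163301459690 ∷ 182829837024385792162049
   ∷ 1557610130363393443337 ∷ 35402881289884292406340829681 ∷ [])
  ∷ (4891519823400896815284437 ∷ 1979310646607864955246593 ∷ 195975476956736928542 ∷ 631131038185074907735
   ∷ 706888548510726688305 ∷ 2142424958443738969 ∷ 12647985593684769873739761 ∷ 85252631173829169710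
   ∷ 282899946365871398365116349387 ∷ 432210531212901503062 ∷ [])
  ∷ (24427574161847631389758 ∷ 436843617838580869167844303 ∷ 3458090390361747871530 ∷ 123056944451225702670
   ∷ 16884918538787949336863 ∷ 36863408751350839651387971167639
   ∷ 122025614933856824398817092360800352556481790388535062788222635649977285385136960297 ∷ []) ∷ []

-- The vertices of `D`, the copies and the apex are their own covers, so `χ` does not change them.
-- The covers of 40 and 41 are copies joined to all of D₁ and of D₂, respectively.
covers : List (List ℕ)
covers =
    (42 ∷ 43 ∷ 44 ∷ 45 ∷ 46 ∷ 47 ∷ 48 ∷ 49 ∷ 50 ∷ 9 ∷ [])
  ∷ (51 ∷ 52 ∷ 53 ∷ 54 ∷ 55 ∷ 56 ∷ 57 ∷ 17 ∷ 58 ∷ 59 ∷ [])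
  ∷ (20 ∷ 60 ∷ 22 ∷ 61 ∷ 62 ∷ 63 ∷ 64 ∷ 65 ∷ 66 ∷ 67 ∷ [])
  ∷ (68 ∷ 69 ∷ 70 ∷ 71 ∷ 72 ∷ 35 ∷ 73 ∷ 74 ∷ 38 ∷ 75 ∷ [])
  ∷ (43 ∷ 50 ∷ 42 ∷ 43 ∷ 44 ∷ 45 ∷ 46 ∷ 47 ∷ 48 ∷ 49 ∷ [])
  ∷ (50 ∷ 51 ∷ 52 ∷ 53 ∷ 54 ∷ 55 ∷ 56 ∷ 57 ∷ 58 ∷ 59 ∷ [])
  ∷ (60 ∷ 61 ∷ 62 ∷ 63 ∷ 64 ∷ 65 ∷ 66 ∷ 67 ∷ 68 ∷ 69 ∷ [])
  ∷ (70 ∷ 71 ∷ 72 ∷ 73 ∷ 74 ∷ 75 ∷ 76 ∷ []) ∷ []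

colours : List (List ℕ)
colours =
    (1 ∷ 5 ∷ 3 ∷ 1 ∷ 1 ∷ 1 ∷ 0 ∷ 0 ∷ 2 ∷ 0 ∷ [])
  ∷ (2 ∷ 0 ∷ 0 ∷ 2 ∷ 0 ∷ 2 ∷ 3 ∷ 2 ∷ 3 ∷ 1 ∷ [])
  ∷ (1 ∷ 1 ∷ 3 ∷ 1 ∷ 0 ∷ 1 ∷ 1 ∷ 3 ∷ 0 ∷ 2 ∷ [])
  ∷ (5 ∷ 0 ∷ 2 ∷ 2 ∷ 0 ∷ 4 ∷ 4 ∷ 3 ∷ 1 ∷ 2 ∷ [])
  ∷ (1 ∷ 0 ∷ 1 ∷ 3 ∷ 3 ∷ 1 ∷ 4 ∷ 4 ∷ 4 ∷ 5 ∷ [])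
  ∷ (2 ∷ 2 ∷ 4 ∷ 2 ∷ 2 ∷ 4 ∷ 2 ∷ 3 ∷ 3 ∷ 1 ∷ [])
  ∷ (1 ∷ 1 ∷ 6 ∷ 1 ∷ 4 ∷ 3 ∷ 3 ∷ 2 ∷ 5 ∷ 3 ∷ [])
  ∷ (2 ∷ 2 ∷ 4 ∷ 4 ∷ 3 ∷ 2 ∷ 0 ∷ []) ∷ []

-- D₁ precedes D₂. The sets `J` of the certificates follow this order, because `covered` compares
-- them as lists.
D : List ℕ
D = 9 ∷ 17 ∷ 35 ∷ 20 ∷ 22 ∷ 38 ∷ []

nth : ∀ {A : Set} → A → List A → ℕ → A
nth d []       i       = d
nth d (x ∷ xs) zero    = x
nth d (x ∷ xs) (suc i) = nth d xs i

entry : List (List ℕ) → ℕ → ℕ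
entry xss i = nth 0 (nth [] xss (div-helper 0 9 i 9)) (mod-helper 0 9 i 9)

label row cover colour : ℕ → ℕ
label  = entry labelTable
row    = entry rows
cover  = entry covers
colour = entry colours

labels : List ℕ
labels = concat labelTable

open KGraphs labels label row cover D

-- The graph H, its triangle-freeness and its 7-colouring.

prime-labels : all (λ m → ⌊ prime? (suc m) ⌋) labels ≡ true
prime-labels = refl

forAll : (ℕ → Bool) → Bool
forAll p = all p (upTo 77)

forAll-elim : ∀ p → forAll p ≡ true → ∀ (u : Fin 77) → p (toℕ u) ≡ true
forAll-elim p t u = all-lookup p (upTo 77) t (∈-upTo⁺ (Fin.toℕ<n u))

symmetricᵇ triangleFreeᵇ properᵇ : ℕ → ℕ → Bool
symmetricᵇ i j = not (adjᵇ i j xor adjᵇ j i)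
-- A triangle on this edge would give a label dividing both rows.
triangleFreeᵇ i j = adjᵇ i j ⇒ᵇ noCommon (row i) (row j)
  where
  noCommon : ℕ → ℕ → Bool
  noCommon r r′ = all (λ m → not (dividesᵇ m r ∧ dividesᵇ m r′)) (labels)
properᵇ i j = adjᵇ i j ⇒ᵇ not ⌊ (colour i mod 7) Fin.≟ (colour j mod 7) ⌋

labels-complete : forAll (λ i → memᵇ (label i) (labels)) ≡ true
labels-complete = refl
symmetric : forAll (λ i → forAll (symmetricᵇ i)) ≡ true
symmetric = refl
irreflexive : forAll (λ i → not (adjᵇ i i)) ≡ true
irreflexive = refl
triangleFree : forAll (λ i → forAll (triangleFreeᵇ i)) ≡ true
triangleFree = refl
proper : forAll (λ i → forAll (properᵇ i)) ≡ true
proper = refl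

H : Graph 77
adj H u v  = adjᵇ (toℕ u) (toℕ v)
sym H u v  = Bool-≡ (forAll-elim (symmetricᵇ (toℕ u)) (forAll-elim (λ i → forAll (symmetricᵇ i)) symmetric u) v)
  where
  Bool-≡ : ∀ {x y} → not (x xor y) ≡ true → x ≡ y
  Bool-≡ {true}  {true}  _ = refl
  Bool-≡ {false} {false} _ = refl
irrefl H v = Bool.not-injective (forAll-elim (λ i → not (adjᵇ i i)) irreflexive v)

H-triangle-free : TriangleFree H
H-triangle-free u v w uv vw uw = not-elim (all-lookup common (labels) none (label∈ w))
    (both (divides w u (trans (sym H w u) uw)) (divides w v (trans (sym H w v) vw)))
  where
  common : ℕ → Bool
  common m = not (dividesᵇ m (row (toℕ u)) ∧ dividesᵇ m (row (toℕ v)))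
  none : all common (labels) ≡ true
  none = ⇒ᵇ-elim (forAll-elim (triangleFreeᵇ (toℕ u)) (forAll-elim (λ i → forAll (triangleFreeᵇ i)) triangleFree u) v) uv
  label∈ : ∀ (w : Fin 77) → label (toℕ w) ∈ labels
  label∈ w = memᵇ⇒∈ (label (toℕ w)) (labels) (forAll-elim (λ i → memᵇ (label i) (labels)) labels-complete w)
  divides : ∀ w u → adj H w u ≡ true → dividesᵇ (label (toℕ w)) (row (toℕ u)) ≡ true
  divides w u t = ∧-conicalʳ (toℕ u <ᵇ 77) _ (∧-conicalʳ (toℕ w <ᵇ 77) _ t)
  both : ∀ {x y} → x ≡ true → y ≡ true → x ∧ y ≡ true
  both refl refl = refl

H-colourable : Colourable H 7
H-colourable = (λ u → colour (toℕ u) mod 7) , λ u v uv eq →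
  not-elim (⇒ᵇ-elim (forAll-elim (properᵇ (toℕ u)) (forAll-elim (λ i → forAll (properᵇ i)) proper u) v) uv)
    (Equivalence.to T-≡ (fromWitness eq))

toℕ-mod : ∀ {i} → (i <ᵇ 77) ≡ true → toℕ (i mod 77) ≡ i
toℕ-mod {i} t = trans (Fin.toℕ-fromℕ< _) (m<n⇒m%n≡m (ℕ.<ᵇ⇒< i 77 (Equivalence.from T-≡ t)))

H-not-colourable : ∀ cs → All ValidCertificate cs → all (covered cs) (sublists D) ≡ true → ¬ Colourable H 6
H-not-colourable cs oks cov (φ , φ-proper) = Soundness.not-colourable
  (λ {m} p → toWitness (Equivalence.from T-≡ (all-lookup (λ m → ⌊ prime? (suc m) ⌋) labels prime-labels p)))
  -- This extends the colouring to all numbers; `adjᵇ` holds only below 77, where nothing changes.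
  (λ i → φ (i mod 77))
  (λ i j t → φ-proper (i mod 77) (j mod 77) (trans (cong₂ adjᵇ (toℕ-mod {i} (∧-conicalˡ _ _ t))
    (toℕ-mod {j} (∧-conicalˡ _ _ (∧-conicalʳ (i <ᵇ 77) _ t)))) t))
  cs oks cov

-- The graphs K_J and their sets that are not 4-colourable.

block∅ : Block
block∅ = block [] (upTo 42)
  (720852348025 ∷ 720867028088 ∷ 712352590968 ∷ 708579720541 ∷ 708594433113 ∷ 708594400605 ∷ 708579753049
  ∷ 717050149977 ∷ 760152618495 ∷ 717035469913 ∷ 708580785241 ∷ 127526609727 ∷ 777347429877 ∷ 760169395703
  ∷ 717036502105 ∷ 790089803004 ∷ 218852816127 ∷ 785803179261 ∷ 790224020980 ∷ 777332749821 ∷ 805195327943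
  ∷ 760187198847 ∷ 760186166655 ∷ 710209301610 ∷ 627047536943 ∷ 710678702447 ∷ 298027871735 ∷ 712342031467
  ∷ 764485323119 ∷ 785788499197 ∷ 768642178175 ∷ 781642491380 ∷ 824516387318 ∷ 101823914175 ∷ 435466823159
  ∷ 257574396415 ∷ 708580752733 ∷ 790075139325 ∷ 824382431486 ∷ 136116543807 ∷ 97554134159 ∷ 807346971127
  ∷ 433587516917 ∷ 298295782767 ∷ 718857956458 ∷ 234993022159 ∷ 807338615287 ∷ 222208516351 ∷ 280848362996
  ∷ 125387519663 ∷ 222216954111 ∷ 101832307887 ∷ 125127490231 ∷ 239833295038 ∷ 125471422095 ∷ 764451768815
  ∷ 824524743159 ∷ 222208510207 ∷ 1055014807031 ∷ 772123511423 ∷ 136124937519 ∷ 125471424135 ∷ 805069466055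
  ∷ 768643210367 ∷ 222778411263 ∷ 95406653063 ∷ 789303385691 ∷ 222786857215 ∷ 279105092985 ∷ 296150646141
  ∷ 298297998639 ∷ 234556913130 ∷ 296282815865 ∷ 296148565373 ∷ 245386566391 ∷ 247500491519 ∷ 39471543038
  ∷ 222208619002 ∷ 332701724103 ∷ 822247238087 ∷ 822373099974 ∷ 127526609599 ∷ 830469434488 ∷ 789320158842
  ∷ 222208614907 ∷ 219692194551 ∷ 222208612858 ∷ 262633545431 ∷ 41774197625 ∷ 56752076494 ∷ 234993153230
  ∷ 796546656711 ∷ 813724428743 ∷ 257163643647 ∷ 41774195579 ∷ 232845541063 ∷ 234993016031 ∷ 99424795319
  ∷ 686944002366 ∷ 783608053249 ∷ 813724461510 ∷ 796543641987 ∷ 222208608763 ∷ 236872064727 ∷ 274360290046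
  ∷ 782534311557 ∷ 687011112252 ∷ 758559438322 ∷ 222376549111 ∷ 784696407245 ∷ 764452948395 ∷ 784696472717
  ∷ 222208651518 ∷ 644592170925 ∷ 782534246085 ∷ 234993147102 ∷ 685476099555 ∷ 41363155709 ∷ 178785340157
  ∷ 135726593386 ∷ 805066467715 ∷ 39194721023 ∷ 239556419287 ∷ 256522285434 ∷ 39626732410 ∷ 38934673406
  ∷ 128331918014 ∷ 644726355948 ∷ 758542661114 ∷ 599578867698 ∷ 646236208769 ∷ 676024155795 ∷ 222208645374
  ∷ 652684930232 ∷ 239824329951 ∷ 256522264955 ∷ 678188396218 ∷ 43430934522 ∷ 807334398447 ∷ 775737472501
  ∷ 239816539295 ∷ 775722792444 ∷ 648398371977 ∷ 646754334125 ∷ 685341914415 ∷ 47658792954 ∷ 687145329972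
  ∷ 687078220086 ∷ 43296749566 ∷ 622752570687 ∷ 783742304076 ∷ 187853065209 ∷ 646888519141 ∷ 787693305363
  ∷ 600107361143 ∷ 595351009266 ∷ 187802790777 ∷ 135726577003 ∷ 649415489213 ∷ 331008685871 ∷ 572840265839
  ∷ 760157986235 ∷ 787961740817 ∷ 179196382201 ∷ 296150515007 ∷ 187584662269 ∷ 737424386929 ∷ 776226004191
  ∷ 766495219319 ∷ 650522787473 ∷ 993878713846 ∷ 763295832506 ∷ 780439020019 ∷ 770513427063 ∷ 572773484138
  ∷ 1059440152973 ∷ 572773145711 ∷ 574904114267 ∷ 926363259301 ∷ 187525999357 ∷ 574904112747 ∷ 772262707823
  ∷ 974614548877 ∷ 789316933211 ∷ 331092588431 ∷ 718857677038 ∷ 313968148345 ∷ 776240428287 ∷ 332703952263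
  ∷ 652012197483 ∷ 772132870783 ∷ 760040553907 ∷ 976766223796 ∷ 736945078072 ∷ 772137063039 ∷ 331147114346
  ∷ 772261661295 ∷ 832619002969 ∷ 1093392476926 ∷ 296150531511 ∷ 782659137478 ∷ 331092588494 ∷ 737515413432
  ∷ 1059440062925 ∷ 1097623488106 ∷ 1063638345207 ∷ 331147097963 ∷ 717050672333 ∷ 747829604330 ∷ 607061656526
  ∷ 974748775565 ∷ 976556502200 ∷ 331628277702 ∷ 763261252082 ∷ 789312740955 ∷ 976497798200 ∷ 1093257216974
  ∷ 782534237911 ∷ 789325399674 ∷ 331145936746 ∷ 772128752255 ∷ 719394545918 ∷ 845772765661 ∷ 978976608677
  ∷ 776225742079 ∷ 280579403132 ∷ 514425716375 ∷ 514442734270 ∷ 789308626523 ∷ 976833316276 ∷ 823747789774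
  ∷ 977093371068 ∷ 256665567999 ∷ 710812950783 ∷ 313966067576 ∷ 978506873881 ∷ 789459617386 ∷ 806555337455
  ∷ 1091896191942 ∷ 763262290363 ∷ 331629461383 ∷ 375652974215 ∷ 1027021827690 ∷ 514442218238 ∷ 960159356523
  ∷ 991794328013 ∷ 514425970391 ∷ 514442746614 ∷ 719395332286 ∷ 771851100663 ∷ 824254245838 ∷ 926329701813
  ∷ 1097489270394 ∷ 735485661108 ∷ 789442840171 ∷ 710745842943 ∷ 807074376655 ∷ 1097464092283 ∷ 789458570858
  ∷ 979110835373 ∷ 806567920591 ∷ 807335578027 ∷ 1011855224440 ∷ 807057607407 ∷ 314385494004 ∷ 718858463422
  ∷ 766629404543 ∷ 737491438585 ∷ 977034667196 ∷ 784693075902 ∷ 1011766083193 ∷ 1093127193342 ∷ 256874564349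
  ∷ 273862214398 ∷ 514442754742 ∷ 789441793643 ∷ 828592994781 ∷ 626510697007 ∷ 634832196143 ∷ 881838167855
  ∷ 418287309300 ∷ 1010362068980 ∷ 375669735087 ∷ 535854590654 ∷ 784681858252 ∷ 978476170769 ∷ 847617758827
  ∷ 881871460143 ∷ 978565299768 ∷ 403209759422 ∷ 572706048367 ∷ 1058485697281 ∷ 856207726187 ∷ 858439619175
  ∷ 839027865211 ∷ 961888945980 ∷ 841175873107 ∷ 944214020909 ∷ 979013041665 ∷ 942068634413 ∷ 974581783437
  ∷ 806143861107 ∷ 944742342584 ∷ 974748515849 ∷ 332098959279 ∷ 535854795516 ∷ 921497982437 ∷ 961855133502
  ∷ 176678755060 ∷ 710678700535 ∷ 858338956883 ∷ 925400399505 ∷ 991881379393 ∷ 336461035407 ∷ 780438888951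
  ∷ 782533299926 ∷ 198048645098 ∷ 403243024062 ∷ 535854611126 ∷ 737423227704 ∷ 891636635618 ∷ 572638928239
  ∷ 782533308102 ∷ 296141859709 ∷ 719268684279 ∷ 776105237950 ∷ 961821837118 ∷ 806143881586 ∷ 737523801016
  ∷ 858338924115 ∷ 185335732980 ∷ 232844611286 ∷ 332359499447 ∷ 856308400750 ∷ 535854668534 ∷ 331148031850
  ∷ 758958939578 ∷ 903414010765 ∷ 942596956089 ∷ 39625554808 ∷ 279071140729 ∷ 331093501902 ∷ 882367174463
  ∷ 920577110988 ∷ 332652494639 ∷ 839059336824 ∷ 889488627690 ∷ 1062839352849 ∷ 177047723000 ∷ 187851889656
  ∷ 583561679463 ∷ 921632232877 ∷ 1062570917395 ∷ 313967230841 ∷ 540195520151 ∷ 886233617358 ∷ 961226381093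
  ∷ 1050347001333 ∷ 331148015467 ∷ 332702908295 ∷ 535854721788 ∷ 771883670458 ∷ 950901767827 ∷ 219691277046
  ∷ 887408777186 ∷ 364861336382 ∷ 979110543017 ∷ 718731848174 ∷ 906096139145 ∷ 919486846956 ∷ 658601395087
  ∷ 976556469944 ∷ 535854664446 ∷ 885260769258 ∷ 921113853569 ∷ 903950752649 ∷ 960353998307 ∷ 961956054838
  ∷ 776231099582 ∷ 953065946810 ∷ 332376194751 ∷ 882400466751 ∷ 905559397261 ∷ 232844619462 ∷ 401422777991
  ∷ 962023163700 ∷ 976699098612 ∷ 56751025862 ∷ 279070621561 ∷ 1064198307378 ∷ 776218746334 ∷ 950918463163
  ∷ 193921535702 ∷ 540195774167 ∷ 885126584302 ∷ 782659129302 ∷ 187583617788 ∷ 961360598829 ∷ 784681852126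
  ∷ 332342934207 ∷ 966293051865 ∷ 187801631608 ∷ 961427707687 ∷ 919621031916 ∷ 976465264184 ∷ 1056252478964
  ∷ 806563857071 ∷ 297994615805 ∷ 845737163741 ∷ 784818937534 ∷ 401372364463 ∷ 296149466943 ∷ 544578718460
  ∷ 806576440207 ∷ 776225879294 ∷ 544578063102 ∷ 807067175599 ∷ 828557360093 ∷ 961326782255 ∷ 970588019192
  ∷ 993736338110 ∷ 527398185727 ∷ 221939161854 ∷ 416510102521 ∷ 280814812156 ∷ 296149729149 ∷ 1093264724879
  ∷ 961293489967 ∷ 959743563581 ∷ 1091771562887 ∷ 976733723580 ∷ 960187831087 ∷ 995730750007 ∷ 959215212333
  ∷ 991761857485 ∷ 892710328103 ∷ 807079758735 ∷ 976430149116 ∷ 776113495551 ∷ 527398841085 ∷ 763261110783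
  ∷ 425099766649 ∷ 296149483447 ∷ 425099774969 ∷ 893238806327 ∷ [])

-- G itself with the fixed vertex 19 in front; its sets are those of `block∅`.
block-G : Block
block-G = block [] (19 ∷ 0 ∷ 1 ∷ 2 ∷ 3 ∷ 4 ∷ 5 ∷ 6 ∷ 7 ∷ 8 ∷ 9 ∷ 10 ∷ 11 ∷ 12 ∷ 13 ∷ 14 ∷ 15 ∷ 16 ∷ 17 ∷ 18 ∷ 20 ∷ 21 ∷ 22 ∷ 23 ∷ 24
  ∷ 25 ∷ 26 ∷ 27 ∷ 28 ∷ 29 ∷ 30 ∷ 31 ∷ 32 ∷ 33 ∷ 34 ∷ 35 ∷ 36 ∷ 37 ∷ 38 ∷ 39 ∷ []) []

-- A subgraph that is not 5-colourable suffices: besides the rest of G, this block has z₁ and eight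
-- of the copies.
block-9 : Block
block-9 = block (9 ∷ [])
  (19 ∷ 0 ∷ 1 ∷ 2 ∷ 3 ∷ 4 ∷ 5 ∷ 6 ∷ 7 ∷ 8 ∷ 10 ∷ 11 ∷ 12 ∷ 13 ∷ 14 ∷ 15 ∷ 16 ∷ 17 ∷ 18 ∷ 20 ∷ 21 ∷ 22 ∷ 23 ∷ 24 ∷ 25
  ∷ 26 ∷ 27 ∷ 28 ∷ 29 ∷ 30 ∷ 31 ∷ 32 ∷ 33 ∷ 34 ∷ 35 ∷ 36 ∷ 37 ∷ 38 ∷ 39 ∷ 40 ∷ 52 ∷ 53 ∷ 58 ∷ 66 ∷ 68 ∷ 57 ∷ 69
  ∷ 73 ∷ [])
  (1385898558676 ∷ 1386963834070 ∷ 9182154967294 ∷ 9182159608062 ∷ 9182223911134 ∷ 10281736061150 ∷ 9190749543606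
  ∷ 10281673330942 ∷ 9190744902902 ∷ 10290267538676 ∷ 9190753291508 ∷ 10221610898646 ∷ 9190822497492
  ∷ 10290263266486 ∷ 10290334647508 ∷ 10281669214462 ∷ 10290259154102 ∷ 9190814108886 ∷ 10290326258902
  ∷ 1412767060062 ∷ 1403042513820 ∷ 10213020831838 ∷ 17758000377740 ∷ 17749186047728 ∷ 9208220199836
  ∷ 9199630265246 ∷ 9199621884382 ∷ 18098113866992 ∷ 8924675033598 ∷ 10307478602652 ∷ 17749378985960
  ∷ 17749187084018 ∷ 18857244616604 ∷ 10023937622526 ∷ 10298882376158 ∷ 8933273356796 ∷ 18857288656596
  ∷ 17757775982292 ∷ 18140281809804 ∷ 10298888668062 ∷ 18857288644310 ∷ 18097367265256 ∷ 10032535945724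
  ∷ 252741160388862 ∷ 17589127162364 ∷ 252741229332702 ∷ 18141029968380 ∷ 252741165029630 ∷ 43587693559538
  ∷ 17588378512268 ∷ 28036566991772 ∷ 43587692527344 ∷ 43596523630476 ∷ 252466500585982 ∷ 17548341771504
  ∷ 18105697168596 ∷ 252741447436766 ∷ 17555941846228 ∷ 252749754965174 ∷ 252749750328502 ∷ 17548313443570
  ∷ 43596282461908 ∷ 1428812448542 ∷ 252749827919060 ∷ 51292795287134 ∷ 28036602643668 ∷ 252749758713076
  ∷ 252749819530454 ∷ 18857219569246 ∷ 252475098909180 ∷ 43587902238696 ∷ 28036535534836 ∷ 18857244747550
  ∷ 252741455817630 ∷ 252750045760412 ∷ 28036539716854 ∷ 17758001557262 ∷ 18098086067442 ∷ 27967887348950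
  ∷ 10298886701406 ∷ 9199626733918 ∷ 51292837246750 ∷ 51292837246876 ∷ 51292864509652 ∷ 218791637926686
  ∷ 218799687025564 ∷ 51292864493270 ∷ 9199633025822 ∷ 51569344550102 ∷ 10298892993310 ∷ 218422926866132
  ∷ 28036501979644 ∷ 51595164422238 ∷ 43596524289806 ∷ 33865539948638 ∷ 51594029945630 ∷ 33864405467934
  ∷ 218725092659294 ∷ 43935891042280 ∷ 218801870161108 ∷ 218420752152476 ∷ 252741452286302 ∷ 218799690732318
  ∷ 218420752672542 ∷ 218422857676382 ∷ 218733137564886 ∷ 33838671578324 ∷ 271364212297822 ∷ 218793779118430
  ∷ 33839736853718 ∷ 218422926849750 ∷ 218791633732510 ∷ 218733666047190 ∷ 218802318415030 ∷ 18140220091150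
  ∷ 218801789932790 ∷ 17588316793614 ∷ 271432898298206 ∷ 252741458578206 ∷ 218799622013436 ∷ 218733154373726
  ∷ 271432904590110 ∷ 218801803052276 ∷ 271432927658206 ∷ 218793808478430 ∷ 33838635664284 ∷ 218802398643414
  ∷ 218793774924254 ∷ 27967887478878 ∷ 218802314761398 ∷ 28036571317022 ∷ 271432894104030 ∷ 253978117312766
  ∷ 271157949350398 ∷ 271432864927998 ∷ 271441490330524 ∷ 271432900395934 ∷ 218518830170622 ∷ 271432860811518
  ∷ 271441454863542 ∷ 271372802495702 ∷ 271441517855958 ∷ 271441526244564 ∷ 218793741631742 ∷ 271166547673596
  ∷ 271441450747126 ∷ 271441459135732 ∷ [])

block-17 : Block
block-17 = block (17 ∷ [])
  (19 ∷ 0 ∷ 1 ∷ 2 ∷ 3 ∷ 4 ∷ 5 ∷ 6 ∷ 7 ∷ 8 ∷ 9 ∷ 10 ∷ 11 ∷ 12 ∷ 13 ∷ 14 ∷ 15 ∷ 16 ∷ 18 ∷ 20 ∷ 21 ∷ 22 ∷ 23 ∷ 24 ∷ 25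
  ∷ 26 ∷ 27 ∷ 28 ∷ 29 ∷ 30 ∷ 31 ∷ 32 ∷ 33 ∷ 34 ∷ 35 ∷ 36 ∷ 37 ∷ 38 ∷ 39 ∷ 40 ∷ 48 ∷ 50 ∷ 53 ∷ 73 ∷ 67 ∷ [])
  (1413035340382 ∷ 1481738064734 ∷ 1410887858814 ∷ 1248660585054 ∷ 1247586843262 ∷ 1247586876270 ∷ 1497783522062
  ∷ 1265863678734 ∷ 1502044934926 ∷ 1479590591358 ∷ 1479531887470 ∷ 1412766966878 ∷ 1416927716446 ∷ 1503179477854
  ∷ 1265016729182 ∷ 1428812433182 ∷ 1265058696990 ∷ 1265327136526 ∷ 33933376542470 ∷ 1502793663838 ∷ 33869700605022
  ∷ 33700609224286 ∷ 1503045326174 ∷ 33865539855454 ∷ 1502799955742 ∷ 33701456183054 ∷ 33700651716382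
  ∷ 33937637955334 ∷ 1646144751390 ∷ 1503051618078 ∷ 33864405452574 ∷ 1645398185742 ∷ 33701430853214
  ∷ 1579591609438 ∷ 33938392975134 ∷ 33938386683230 ∷ 33865808229982 ∷ 33934510954326 ∷ 33700919639822
  ∷ 34015198783070 ∷ 34081737254686 ∷ 34080990689038 ∷ 33938644637470 ∷ 33938772498262 ∷ 33938638345566
  ∷ 33863660748414 ∷ 33932304777062 ∷ 33700359208574 ∷ 33932363480950 ∷ 33700359241582 ∷ [])

block-9-17 : Block
block-9-17 = block (9 ∷ 17 ∷ [])
  (19 ∷ 0 ∷ 1 ∷ 2 ∷ 3 ∷ 4 ∷ 5 ∷ 6 ∷ 7 ∷ 8 ∷ 10 ∷ 11 ∷ 12 ∷ 13 ∷ 14 ∷ 15 ∷ 16 ∷ 18 ∷ 20 ∷ 21 ∷ 22 ∷ 23 ∷ 24 ∷ 25 ∷ 26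
  ∷ 27 ∷ 28 ∷ 29 ∷ 30 ∷ 31 ∷ 32 ∷ 33 ∷ 34 ∷ 35 ∷ 36 ∷ 37 ∷ 38 ∷ 39 ∷ 40 ∷ 48 ∷ 50 ∷ 52 ∷ 53 ∷ 73 ∷ 57 ∷ 58 ∷ 66
  ∷ 68 ∷ 67 ∷ 69 ∷ [])
  (2905406738526 ∷ 73276231290974 ∷ 298441664981766 ∷ 298443795688198 ∷ 912034743173914 ∷ 631105493779354
  ∷ 630920087037852 ∷ 2913429472030 ∷ 421652184427274 ∷ 911845274412830 ∷ 141370151923470 ∷ 143569040959262
  ∷ 894447120401178 ∷ 71120266840414 ∷ 143569028363870 ∷ 894417877832282 ∷ 912006034002010 ∷ 73319164264798
  ∷ 612426413196184 ∷ 419271560377950 ∷ 73319167410974 ∷ 71120269986590 ∷ 129550281062102 ∷ 439063193153294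
  ∷ 1052674803142746 ∷ 129688521053398 ∷ 613337544750804 ∷ 612393138197718 ∷ 770684428337370 ∷ 128450769712852
  ∷ 894448190996826 ∷ 612423473414362 ∷ 931763060034386 ∷ 631109488428024 ∷ 298442232187734 ∷ 298407880825438
  ∷ 419271581361950 ∷ 612423456637402 ∷ 612427728622774 ∷ 612393402438870 ∷ 770684414706586 ∷ 612427504764116
  ∷ 770684394914042 ∷ 351101994659598 ∷ 612427726542006 ∷ 914170810059546 ∷ 298325692399198 ∷ 894262731060830
  ∷ 612427464381686 ∷ 770684396933370 ∷ 251665068311764 ∷ 612423442075898 ∷ 613337544734422 ∷ 419422177706782
  ∷ 141561261189902 ∷ 128450756077468 ∷ 1052709146181978 ∷ 1052709149328154 ∷ 612285984260602 ∷ 251665600910550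
  ∷ 770684411560410 ∷ 612427768480982 ∷ 914170806913370 ∷ 419422744907870 ∷ 612423439991034 ∷ 542499328004190
  ∷ 612427471209716 ∷ 251665050354588 ∷ 770546939183610 ∷ 298406807084670 ∷ 214095059980382 ∷ 298441129099110
  ∷ 140726994709388 ∷ 542498760803102 ∷ 770688689886390 ∷ 770688710198168 ∷ 770688723436758 ∷ 298441158451062
  ∷ 770654365717718 ∷ 298325156576894 ∷ 214129401905950 ∷ 770688691901622 ∷ 298325156593518 ∷ 770688728155348
  ∷ 770551238869496 ∷ 770688694600948 ∷ [])

block-35 : Block
block-35 = block (35 ∷ [])
  (17 ∷ 0 ∷ 1 ∷ 2 ∷ 3 ∷ 4 ∷ 5 ∷ 6 ∷ 7 ∷ 8 ∷ 9 ∷ 10 ∷ 11 ∷ 12 ∷ 13 ∷ 14 ∷ 15 ∷ 16 ∷ 18 ∷ 19 ∷ 20 ∷ 21 ∷ 22 ∷ 23 ∷ 24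
  ∷ 25 ∷ 26 ∷ 27 ∷ 28 ∷ 29 ∷ 30 ∷ 31 ∷ 32 ∷ 33 ∷ 34 ∷ 36 ∷ 37 ∷ 38 ∷ 39 ∷ 40 ∷ 50 ∷ 47 ∷ 57 ∷ 64 ∷ 68 ∷ 73 ∷ [])
  (25981647051768 ∷ 25981916011496 ∷ 25999095553006 ∷ 26351616803758 ∷ 26351348894638 ∷ 26067815025646
  ∷ 26351080002460 ∷ 26273771672476 ∷ 25998826658780 ∷ 26334026750832 ∷ 26334303554408 ∷ 26334236478312
  ∷ 8740766769008 ∷ 26333968063344 ∷ 39413278859124 ∷ 26336451044170 ∷ 49193534903676 ∷ 26351743484780
  ∷ 17532564823924 ∷ 48984675579246 ∷ 48987074676094 ∷ 49036215170542 ∷ 49038329091582 ∷ 8251183724536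
  ∷ 17549744691068 ∷ 8607095076690 ∷ 39350473139806 ∷ 17550692013980 ∷ 8757946636156 ∷ 39413245083508
  ∷ 48985019510046 ∷ 49451568487796 ∷ 39350465007228 ∷ 26336383968074 ∷ 49053462150574 ∷ 39504982132348
  ∷ 48984935591262 ∷ 17051540180980 ∷ 39567829522300 ∷ 17395093405556 ∷ 39350473078614 ∷ 49193585147182
  ∷ 8606994577234 ∷ 8397111353328 ∷ 26351206617980 ∷ 49193518298478 ∷ 17051506634740 ∷ 8397077807088
  ∷ 49381246532950 ∷ 17481036384156 ∷ 49193535059436 ∷ 49123481386334 ∷ 48985019514126 ∷ 60441320250740
  ∷ 49193535051260 ∷ 49381246594398 ∷ 49383385943420 ∷ 60184360408444 ∷ 8603505244024 ∷ 33804671276412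
  ∷ 49123531881742 ∷ 49193585393070 ∷ 8603236761456 ∷ 17481975711644 ∷ 8606726207322 ∷ 8689238329244
  ∷ 34025256017268 ∷ 33973727561180 ∷ 39419159033686 ∷ 49468434984358 ∷ 60441287523684 ∷ 49451535891750
  ∷ 60458199330276 ∷ 33974801106396 ∷ 60184360449388 ∷ 49381246758174 ∷ 34043509036508 ∷ 49449933667590
  ∷ 33787626096126 ∷ 34042435884412 ∷ 33975842024900 ∷ 60184360564204 ∷ 33973694016980 ∷ 34027238653284
  ∷ 33804670899708 ∷ 33975875577292 ∷ 60184360556028 ∷ 33956512071156 ∷ 33804671432172 ∷ 33787625035262
  ∷ 33956545617396 ∷ 34025223552372 ∷ 33804671317356 ∷ 33958662172132 ∷ 34044451288428 ∷ [])

block-9-35 : Block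
block-9-35 = block (9 ∷ 35 ∷ [])
  (19 ∷ 0 ∷ 1 ∷ 2 ∷ 3 ∷ 4 ∷ 5 ∷ 6 ∷ 7 ∷ 8 ∷ 10 ∷ 11 ∷ 12 ∷ 13 ∷ 14 ∷ 15 ∷ 16 ∷ 17 ∷ 18 ∷ 20 ∷ 21 ∷ 22 ∷ 23 ∷ 24 ∷ 25
  ∷ 26 ∷ 27 ∷ 28 ∷ 29 ∷ 30 ∷ 31 ∷ 32 ∷ 33 ∷ 34 ∷ 36 ∷ 37 ∷ 38 ∷ 39 ∷ 40 ∷ 52 ∷ 50 ∷ 57 ∷ 68 ∷ 47 ∷ 53 ∷ 58 ∷ 66
  ∷ 73 ∷ 64 ∷ 69 ∷ [])
  (290467446074254 ∷ 290467509021582 ∷ 8988207967118 ∷ 8996796853134 ∷ 290476097907596 ∷ 4469148204786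
  ∷ 4477737103060 ∷ 281681076528108 ∷ 5027493963476 ∷ 8996796885900 ∷ 281535044477950 ∷ 290476034960270
  ∷ 4653859597524 ∷ 4469147168496 ∷ 4646276295920 ∷ 9494762996636 ∷ 281681009680892 ∷ 4469348495336
  ∷ 281672491803630 ∷ 5027493951190 ∷ 281672487642094 ∷ 352041091320286 ∷ 351903583422974 ∷ 75590480544980
  ∷ 281681080689646 ∷ 281672485522398 ∷ 352453090198014 ∷ 352590595998174 ∷ 360845782666140 ∷ 8876555071374
  ∷ 351912181746172 ∷ 352461688521212 ∷ 75590413436148 ∷ 361395287344028 ∷ 13274065006476 ∷ 4646248496370
  ∷ 222436294478846 ∷ 1023567530936574 ∷ 75556124988630 ∷ 75590417618166 ∷ 4645538082792 ∷ 286146989238780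
  ∷ 294942344063884 ∷ 222573741810670 ∷ 13823553431452 ∷ 360837192731550 ∷ 1023567599880414 ∷ 1023567535577342
  ∷ 8988208622342 ∷ 222582326535148 ∷ 222582259687932 ∷ 222573737649134 ∷ 222582330696686 ∷ 361386697409438
  ∷ 1023576125512886 ∷ 1023576120876214 ∷ 290467446745862 ∷ 1023576198466772 ∷ 1023576129260788 ∷ 65766904676082
  ∷ 1023576190078166 ∷ 65766903643888 ∷ 281672486177622 ∷ 222573735529438 ∷ 9503353062174 ∷ 288977132941070
  ∷ 65767113355240 ∷ 135594413373022 ∷ 357065356591612 ∷ 290188305328902 ∷ 365861516723100 ∷ 750760024713724
  ∷ 352041096169822 ∷ 288977131892622 ∷ 65775493578452 ∷ 352590600323422 ∷ 750751426398718 ∷ 290188306901894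
  ∷ 407173785433950 ∷ 219823822564098 ∷ 219823824120706 ∷ 8876556250894 ∷ 5027426973278 ∷ 219821739584394
  ∷ 759209652077464 ∷ 136312749112562 ∷ 290196895787910 ∷ 223123491998546 ∷ 136312777440496 ∷ 750888934296030
  ∷ 407173827393310 ∷ 759019762841500 ∷ 759201602978586 ∷ 407173827393436 ∷ 267169410841346 ∷ 361386701734686
  ∷ 135741029126750 ∷ 136772956360798 ∷ 759209656304410 ∷ 360837197581086 ∷ 218612683730702 ∷ 219832413006726
  ∷ 135594482579158 ∷ 135594482595540 ∷ 136320360742100 ∷ 75556125118558 ∷ 290196895820684 ∷ 219830328470412
  ∷ 408419982020958 ∷ 267177455778570 ∷ 218612682682254 ∷ 13823553562398 ∷ 266988510773006 ∷ 764639027381144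
  ∷ 764630441640730 ∷ 1050540005036634 ∷ 747588263070490 ∷ 65943303466984 ∷ 337501681351430 ∷ 747588260440986
  ∷ 136763267859668 ∷ 337355107467022 ∷ 750888651889150 ∷ 759019695765278 ∷ 747596850383768 ∷ 412749240451870
  ∷ 136764333135062 ∷ 1053769814675546 ∷ 13274066185998 ∷ 337355106938764 ∷ 759169423676250 ∷ 759201598784410
  ∷ 747450754640378 ∷ 764630437446554 ∷ 1050392382649950 ∷ 266988510244748 ∷ 407320401269534 ∷ 759177477067610
  ∷ 267177518148492 ∷ 267169474259850 ∷ 747459344574968 ∷ 1050548058427994 ∷ 412749240374110 ∷ 750888939145562
  ∷ 759021834843998 ∷ 1050582399800532 ∷ 1050392451839700 ∷ 268277778426364 ∷ 412740650517404 ∷ 772329164226906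
  ∷ 1053804170297562 ∷ 1050392451823318 ∷ 764598262862682 ∷ 1050548043715798 ∷ 772294837965146 ∷ 764501523677688
  ∷ 1050574361182938 ∷ 219831335365116 ∷ 759209587065848 ∷ 1050582336345334 ∷ 365861521048350 ∷ 772329160032730
  ∷ 1053804103450874 ∷ 772191654232570 ∷ 1053804107567354 ∷ 1050582349464820 ∷ 764492933743098 ∷ 294942282869518
  ∷ 1053812768883924 ∷ 1053812697502902 ∷ 1053778404873430 ∷ 760163606708730 ∷ 1053812760495318 ∷ 1050574300025082
  ∷ 759211754985462 ∷ 1053812693390518 ∷ 1053812701775092 ∷ 1050574296432890 ∷ 772329130856954 ∷ 760303230292474
  ∷ 764632557851130 ∷ [])

block-17-35 : Block
block-17-35 = block (17 ∷ 35 ∷ [])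
  (9 ∷ 0 ∷ 1 ∷ 2 ∷ 3 ∷ 4 ∷ 5 ∷ 6 ∷ 7 ∷ 8 ∷ 10 ∷ 11 ∷ 12 ∷ 13 ∷ 14 ∷ 15 ∷ 16 ∷ 18 ∷ 19 ∷ 20 ∷ 21 ∷ 22 ∷ 23 ∷ 24 ∷ 25
  ∷ 26 ∷ 27 ∷ 28 ∷ 29 ∷ 30 ∷ 31 ∷ 32 ∷ 33 ∷ 34 ∷ 36 ∷ 37 ∷ 38 ∷ 39 ∷ 40 ∷ 50 ∷ 48 ∷ 47 ∷ 73 ∷ 53 ∷ 57 ∷ 64 ∷ 67
  ∷ 68 ∷ [])
  (81195042853354 ∷ 81169272831470 ∷ 15385675724268 ∷ 81356372342254 ∷ 15214682340716 ∷ 81203632567790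
  ∷ 81160683125226 ∷ 15283536010876 ∷ 17497075250148 ∷ 15317358878588 ∷ 17509977430900 ∷ 81238127550078
  ∷ 81288056545150 ∷ 81360732451226 ∷ 15390035833240 ∷ 130806580744266 ∷ 79090663056358 ∷ 60214780338814
  ∷ 85140635579800 ∷ 85209027867544 ∷ 78932344071158 ∷ 79047731727190 ∷ 81344357888410 ∷ 79094958072742
  ∷ 78932352508918 ∷ 81335768043930 ∷ 17476154563444 ∷ 78932344065014 ∷ 161459387483624 ∷ 84986050311580
  ∷ 84979658054140 ∷ 60240621282046 ∷ 85204667758572 ∷ 84979658060284 ∷ 60463272920296 ∷ 81305705281978
  ∷ 15317415632828 ∷ 130798527680586 ∷ 17584715757028 ∷ 17507825753972 ∷ 17365867067348 ∷ 60471845954732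
  ∷ 60394638221998 ∷ 17359692913652 ∷ 79082611303398 ∷ 161601154418152 ∷ 79095495205862 ∷ 79129517430214
  ∷ 85033674882940 ∷ 17359692919796 ∷ 60463340029032 ∷ 15352188516792 ∷ 60438088221802 ∷ 79159785448934
  ∷ 201200752887016 ∷ 17551178087796 ∷ 78938518222806 ∷ 60214784538206 ∷ 81288113299390 ∷ 60403290186348
  ∷ 79082611297270 ∷ 84986050305468 ∷ 131708877087478 ∷ 70110187845332 ∷ 271536009744458 ∷ 79163543594406
  ∷ 17474002886516 ∷ 85136407590396 ∷ 201209325921452 ∷ 131846251029222 ∷ 85136407715260 ∷ 131906075563206
  ∷ 161601019949048 ∷ 15283594862268 ∷ 201200819995752 ∷ 60472447804654 ∷ 131682838984406 ∷ 131862894027430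
  ∷ 85136407584252 ∷ 17589075867076 ∷ 70136225952500 ∷ 81237112659646 ∷ 85096178423932 ∷ 79161729643974
  ∷ 81297115445690 ∷ 237454706174854 ∷ 17586593756646 ∷ 79159248578022 ∷ 201209426551470 ∷ 79164080465382
  ∷ 70273599894244 ∷ 131940638598374 ∷ 85102587321468 ∷ 241173976306154 ∷ 272677581694118 ∷ 85102587452604
  ∷ 272677682356902 ∷ 131940101727398 ∷ 85171181075384 ∷ 78906314405846 ∷ 201209489629804 ∷ 79124906143206
  ∷ 241139616578026 ∷ 17552251845990 ∷ 70367781541060 ∷ 272644094497990 ∷ 241316851077578 ∷ 17475076628342
  ∷ 70367446922406 ∷ 210546598072554 ∷ 237454572219814 ∷ 241182566086126 ∷ 210555171075238 ∷ 70367716406500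
  ∷ 241148206349806 ∷ 70358873919722 ∷ 175332161060262 ∷ 70359744237770 ∷ 210547470487754 ∷ 210556043613382 ∷ [])

block-9-17-35 : Block
block-9-17-35 = block (9 ∷ 17 ∷ 35 ∷ [])
  (19 ∷ 0 ∷ 1 ∷ 2 ∷ 3 ∷ 4 ∷ 5 ∷ 6 ∷ 7 ∷ 8 ∷ 10 ∷ 11 ∷ 12 ∷ 13 ∷ 14 ∷ 15 ∷ 16 ∷ 18 ∷ 20 ∷ 21 ∷ 22 ∷ 23 ∷ 24 ∷ 25 ∷ 26
  ∷ 27 ∷ 28 ∷ 29 ∷ 30 ∷ 31 ∷ 32 ∷ 33 ∷ 34 ∷ 36 ∷ 37 ∷ 38 ∷ 39 ∷ 40 ∷ 50 ∷ 48 ∷ 52 ∷ 53 ∷ 47 ∷ 57 ∷ 68 ∷ 73 ∷ 58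
  ∷ 66 ∷ 64 ∷ 67 ∷ 69 ∷ [])
  (606322676210270 ∷ 5043860105998 ∷ 6126099611934 ∷ 286520967523086 ∷ 422860908513630 ∷ 1805942259826970
  ∷ 1823500086395162 ∷ 909804489763590 ∷ 1805926170399066 ∷ 2091799193620570 ∷ 282123487234910 ∷ 4988033920782
  ∷ 909787318197078 ∷ 1243546087539096 ∷ 2091803220349018 ∷ 423960294310238 ∷ 427258959218974 ∷ 767419865443202
  ∷ 769069132114690 ∷ 19281265800798 ∷ 204468869770122 ∷ 1261099886690714 ∷ 908155223108486 ∷ 1805930197127514
  ∷ 309965065908110 ∷ 825159148147294 ∷ 909748659121934 ∷ 2109357017043034 ∷ 769051977325394 ∷ 606339847703382
  ∷ 1824599723854106 ∷ 428358345015582 ∷ 1823483996967258 ∷ 825085840307806 ∷ 623875623239262 ∷ 227501304182484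
  ∷ 1881775466171218 ∷ 160098731135070 ∷ 1261104182182296 ∷ 1102162791491358 ∷ 310025192041358 ∷ 821878984403714
  ∷ 23679329101598 ∷ 504578221795228 ∷ 1529416174125274 ∷ 1265224125891034 ∷ 767424159886214 ∷ 962524948983566
  ∷ 769013318250254 ∷ 1546699119378650 ∷ 1529325218920148 ∷ 204473164213132 ∷ 1260004797172120 ∷ 962598235925254
  ∷ 1102236078424862 ∷ 1102162770507614 ∷ 1102236078347102 ∷ 909748646461278 ∷ 1119793904993054 ∷ 1260000502204826
  ∷ 227501304166102 ∷ 1827882040332634 ∷ 1827899203502426 ∷ 236057157158100 ∷ 1119793904915294 ∷ 22579951693582
  ∷ 1529403014321366 ∷ 821788534370062 ∷ 1811406654916954 ∷ 364940379025292 ∷ 833921448972382 ∷ 2091725382989406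
  ∷ 236057689756886 ∷ 204414097125262 ∷ 1546699085955322 ∷ 445988917461278 ∷ 1529325218903766 ∷ 310025192074124
  ∷ 522205040329628 ∷ 1243473308533242 ∷ 606321602469502 ∷ 1265155372990970 ∷ 1529420192896212 ∷ 606338744614758
  ∷ 1546699087974650 ∷ 263331505449468 ∷ 259388336500620 ∷ 606338773966710 ∷ 1805852376545118 ∷ 606282901634686
  ∷ 259478818499466 ∷ 1265158598935032 ∷ 1529420161684726 ∷ 769013322366814 ∷ 1243547146850810 ∷ 1546703414478038
  ∷ 2091816341115130 ∷ 1546703380927670 ∷ 1546686236628182 ∷ 1529416141750522 ∷ 1546703382942902 ∷ 606282901651310
  ∷ 304151548390158 ∷ 1265224111264250 ∷ 1529420168774900 ∷ 1243543120286202 ∷ 1546703419196628 ∷ 1546703385642228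
  ∷ [])

block-20 : Block
block-20 = block (20 ∷ [])
  (39 ∷ 0 ∷ 1 ∷ 2 ∷ 3 ∷ 4 ∷ 5 ∷ 6 ∷ 7 ∷ 8 ∷ 9 ∷ 10 ∷ 11 ∷ 12 ∷ 13 ∷ 14 ∷ 15 ∷ 16 ∷ 17 ∷ 18 ∷ 19 ∷ 21 ∷ 22 ∷ 23 ∷ 24
  ∷ 25 ∷ 26 ∷ 27 ∷ 28 ∷ 29 ∷ 30 ∷ 31 ∷ 32 ∷ 33 ∷ 34 ∷ 35 ∷ 36 ∷ 37 ∷ 38 ∷ 41 ∷ 61 ∷ 63 ∷ 60 ∷ 74 ∷ [])
  (4617737713132 ∷ 4634917584300 ∷ 4596095057876 ∷ 4454797540748 ∷ 4591968042412 ∷ 4630891068812 ∷ 4574725256680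
  ∷ 4619985335804 ∷ 4620422067694 ∷ 4583382169064 ∷ 4620555761150 ∷ 4637601938862 ∷ 4575094355952 ∷ 4437672195824
  ∷ 4585898162160 ∷ 4585629791736 ∷ 4585847977712 ∷ 4654786000362 ∷ 4654919693818 ∷ 4694187243258 ∷ 4712012185328
  ∷ 4729674399628 ∷ 4729192054484 ∷ 13180237423082 ∷ 4712431615976 ∷ 4933900219882 ∷ 4730747551630 ∷ 4694296360690
  ∷ 13077970480106 ∷ 4730748599694 ∷ 12942678481630 ∷ 4938241326510 ∷ 12940532577018 ∷ 4730697088734
  ∷ 4814555559922 ∷ 4912471520750 ∷ 4694295314162 ∷ 12958349131504 ∷ 12977088682894 ∷ 12975562546900
  ∷ 12976015531916 ∷ 4912471522734 ∷ 12923486075634 ∷ 12923487122162 ∷ 13095940371944 ∷ 4925444044282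
  ∷ 12940531530490 ∷ 13184582724014 ∷ 12958768553960 ∷ 4694194585578 ∷ 4694194585338 ∷ 12977089993102
  ∷ 4773698272654 ∷ 13117314105300 ∷ 13060926059506 ∷ 4823144970226 ∷ 13107113015280 ∷ 12976016842124
  ∷ 12958887048944 ∷ 13113187343788 ∷ 13096309209072 ∷ 13104597284328 ∷ 13138957022700 ∷ 13107062830832
  ∷ 13152110370188 ∷ 4823144986354 ∷ 13156136885676 ∷ 13171781248506 ∷ 13158821244334 ∷ 13106844907000
  ∷ 13069481916402 ∷ 13176001111530 ∷ 13158812921262 ∷ 13141641373166 ∷ 13176134804986 ∷ 13158812919278
  ∷ 13069481932530 ∷ 13141775066622 ∷ 13141204645372 ∷ 13020039667086 ∷ [])

block-22 : Block
block-22 = block (22 ∷ [])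
  (20 ∷ 0 ∷ 1 ∷ 2 ∷ 3 ∷ 4 ∷ 5 ∷ 6 ∷ 7 ∷ 8 ∷ 9 ∷ 10 ∷ 11 ∷ 12 ∷ 13 ∷ 14 ∷ 15 ∷ 16 ∷ 17 ∷ 18 ∷ 19 ∷ 21 ∷ 23 ∷ 24 ∷ 25
  ∷ 26 ∷ 27 ∷ 28 ∷ 29 ∷ 30 ∷ 31 ∷ 32 ∷ 33 ∷ 34 ∷ 35 ∷ 36 ∷ 37 ∷ 38 ∷ 39 ∷ 41 ∷ 43 ∷ 65 ∷ 70 ∷ 44 ∷ 62 ∷ 74 ∷ 69
  ∷ [])
  (114154556610772 ∷ 114155623913686 ∷ 114154757216990 ∷ 114180545893326 ∷ 114158880938196 ∷ 114189133730766
  ∷ 114189133927372 ∷ 114181695115998 ∷ 114181678339038 ∷ 114185583432926 ∷ 114210638091212 ∷ 114194182282452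
  ∷ 114202981406174 ∷ 114211579729372 ∷ 114201987273678 ∷ 114203119752158 ∷ 114202050253774 ∷ 114210575111118
  ∷ 114194173893846 ∷ 114168622978522 ∷ 43959998830220 ∷ 70221522162574 ∷ 43926714930826 ∷ 70221585142670
  ∷ 105405894247342 ∷ 70230172980108 ∷ 70230110000014 ∷ 105414482084782 ∷ 70217260782478 ∷ 70225848619918
  ∷ 70225848685452 ∷ 70188237477506 ∷ 105405957227438 ∷ 114168702588866 ∷ 105410220704686 ∷ 105401632867246
  ∷ 114168761325522 ∷ 114168765568714 ∷ 43926589101978 ∷ 105414545064876 ∷ 70188300457610 ∷ 70222524667806
  ∷ 79078872649388 ∷ 70231114602396 ∷ 43960948840344 ∷ 105346900902572 ∷ 79095788349606 ∷ 79044250840230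
  ∷ 105346636868262 ∷ 105410220770220 ∷ 70188166240154 ∷ 105303689293478 ∷ 79044250774694 ∷ 79044515008174
  ∷ 79078608415910 ∷ 105411027332006 ∷ 105303953589934 ∷ 79159239870892 ∷ 79160045119910 ∷ 105402439494566
  ∷ 79072306485176 ∷ 43942600794068 ∷ 79037946746810 ∷ 105415486707644 ∷ 105299524409274 ∷ 114346654457300
  ∷ 105342473820092 ∷ 105406896756670 ∷ [])

block-20-22 : Block
block-20-22 = block (20 ∷ 22 ∷ [])
  (38 ∷ 0 ∷ 1 ∷ 2 ∷ 3 ∷ 4 ∷ 5 ∷ 6 ∷ 7 ∷ 8 ∷ 9 ∷ 10 ∷ 11 ∷ 12 ∷ 13 ∷ 14 ∷ 15 ∷ 16 ∷ 17 ∷ 18 ∷ 19 ∷ 21 ∷ 23 ∷ 24 ∷ 25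
  ∷ 26 ∷ 27 ∷ 28 ∷ 29 ∷ 30 ∷ 31 ∷ 32 ∷ 33 ∷ 34 ∷ 35 ∷ 36 ∷ 37 ∷ 39 ∷ 41 ∷ 43 ∷ 61 ∷ 63 ∷ 60 ∷ 65 ∷ 70 ∷ 74 ∷ 44
  ∷ 62 ∷ 69 ∷ [])
  (316560285967454 ∷ 316564446717022 ∷ 316560554340958 ∷ 43303964342450 ∷ 43303964277434 ∷ 316616254235978
  ∷ 43329767095038 ∷ 43376911677618 ∷ 43410198723714 ∷ 43397678398452 ∷ 60374076458238 ∷ 43404459848958
  ∷ 43406235302840 ∷ 316616387868498 ∷ 61554991639734 ∷ 43409456529304 ∷ 43413049785526 ∷ 52743527234420
  ∷ 350645146191070 ∷ 50544487234420 ∷ 60446886036734 ∷ 61546401703166 ∷ 60455475981494 ∷ 60348273626358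
  ∷ 60455484361972 ∷ 43412245527718 ∷ 43385937016300 ∷ 350718022354142 ∷ 61473588061438 ∷ 50544428514148
  ∷ 61447785229494 ∷ 43403655591150 ∷ 43410265767578 ∷ 316534482873558 ∷ 350618278137044 ∷ 350619343359190
  ∷ 60454671723686 ∷ 60326593398270 ∷ 349545903198814 ∷ 60287132607978 ∷ 43402715019518 ∷ 349614605898582
  ∷ 61554187381926 ∷ 43409393680280 ∷ 70269681345662 ∷ 316573036915926 ∷ 349613473452870 ∷ 350726621203668
  ∷ 50482632823934 ∷ 43401642327278 ∷ 70273842095230 ∷ 350743766992348 ∷ 350735168669150 ∷ 50545295670134
  ∷ 60348282146036 ∷ 52681656054910 ∷ 61545597445358 ∷ 70341755741292 ∷ 270465816253190 ∷ 52731852961128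
  ∷ 60335191721468 ∷ 60446081787118 ∷ 52675616193150 ∷ 50530527018868 ∷ 349549795578974 ∷ 350726612815062
  ∷ 50545236966246 ∷ 61528415741416 ∷ 50532645273456 ∷ 50476592970366 ∷ 52749569700972 ∷ 70324575872360
  ∷ 52729567018868 ∷ 43401709371134 ∷ 316650312664414 ∷ 237411496331038 ∷ 270470077666054 ∷ 50568750404990
  ∷ 50550546478188 ∷ 50533661867872 ∷ 316616222410074 ∷ 43383718182900 ∷ 280266679748508 ∷ 50532779537784
  ∷ 280366432880542 ∷ 280375022815132 ∷ 270436792718850 ∷ 50531543613284 ∷ 70359708042622 ∷ 350701077112266
  ∷ 43383655333884 ∷ 50568884556662 ∷ 52747552177788 ∷ 237485483853598 ∷ 280292449552286 ∷ 50548528955004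
  ∷ 349601552381274 ∷ 270436524293666 ∷ 349636047311702 ∷ 280332342888346 ∷ 70324542481768 ∷ 349634914865990
  ∷ 349635913160030 ∷ 50568825852774 ∷ 270471084349214 ∷ 349601688622930 ∷ 270436725659418 ∷ 270466618424102
  ∷ 349601629919042 ∷ 237451391510298 ∷ [])

block-38 : Block
block-38 = block (38 ∷ [])
  (30 ∷ 0 ∷ 1 ∷ 2 ∷ 3 ∷ 4 ∷ 5 ∷ 6 ∷ 7 ∷ 8 ∷ 9 ∷ 10 ∷ 11 ∷ 12 ∷ 13 ∷ 14 ∷ 15 ∷ 16 ∷ 17 ∷ 18 ∷ 19 ∷ 20 ∷ 21 ∷ 22 ∷ 23
  ∷ 24 ∷ 25 ∷ 26 ∷ 27 ∷ 28 ∷ 29 ∷ 31 ∷ 32 ∷ 33 ∷ 34 ∷ 35 ∷ 36 ∷ 37 ∷ 39 ∷ 41 ∷ 59 ∷ 62 ∷ 63 ∷ 72 ∷ 56 ∷ 66 ∷ 70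
  ∷ [])
  (1155938610782 ∷ 1156106415902 ∷ 1156106416028 ∷ 1157180161806 ∷ 35690231417838 ∷ 1156215467732 ∷ 1156215434966
  ∷ 1139035569906 ∷ 13150245145582 ∷ 35698888559598 ∷ 35684919602148 ∷ 35594996509258 ∷ 35694786964378
  ∷ 13144931232740 ∷ 35694787160858 ∷ 35684852493292 ∷ 35693702998936 ∷ 35595004832454 ∷ 1157177794444
  ∷ 35690298788838 ∷ 35733248559846 ∷ 1156213112532 ∷ 1139033243376 ∷ 35693770107844 ∷ 35561710250826
  ∷ 35596069980778 ∷ 17453132226634 ∷ 35732433332932 ∷ 13055018543302 ∷ 1139872096232 ∷ 35732164373220
  ∷ 13158902287342 ∷ 17551761138584 ∷ 13192444946628 ∷ 1561936461552 ∷ 1561821347570 ∷ 13153781738436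
  ∷ 1642626506636 ∷ 17552847381274 ∷ 13144864123884 ∷ 17419837580106 ∷ 1642377248526 ∷ 36832010751700
  ∷ 13192176003300 ∷ 17552847201178 ∷ 35561710242666 ∷ 36827573178268 ∷ 13056083692138 ∷ 13021723954026
  ∷ 104235356882844 ∷ 1577304383188 ∷ 104218248346864 ∷ 13150312516582 ∷ 104451975843028 ∷ 13193262287078
  ∷ 104235428216020 ∷ 104447538268060 ∷ 104235432389844 ∷ 1561164734440 ∷ 36831742316276 ∷ 36827590283038
  ∷ 1643473690620 ∷ 36694519606998 ∷ 139144817528732 ∷ 104447278220796 ∷ 104447808787964 ∷ 104451707407604
  ∷ 104236392896396 ∷ 104219087200232 ∷ 104366338661616 ∷ 104314486533334 ∷ 104446963701644 ∷ 139127809629936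
  ∷ 104235432357078 ∷ 104381639482580 ∷ 139144993689300 ∷ 104451657051382 ∷ 36694511283806 ∷ 139144989499092
  ∷ 36831690125046 ∷ 104235323606814 ∷ 104235155795550 ∷ 139128581382120 ∷ 104218252508402 ∷ 139144926555862
  ∷ 104447555372830 ∷ 36827313131516 ∷ 139145887080332 ∷ 139144817790750 ∷ 139144649993822 ∷ 104365499834344
  ∷ 139127746690802 ∷ 104236397352718 ∷ 104314545579614 ∷ 104366160379122 ∷ 139145891536654 ∷ 104446716532494 ∷ [])

block-20-38 : Block
block-20-38 = block (20 ∷ 38 ∷ [])
  (39 ∷ 0 ∷ 1 ∷ 2 ∷ 3 ∷ 4 ∷ 5 ∷ 6 ∷ 7 ∷ 8 ∷ 9 ∷ 10 ∷ 11 ∷ 12 ∷ 13 ∷ 14 ∷ 15 ∷ 16 ∷ 17 ∷ 18 ∷ 19 ∷ 21 ∷ 22 ∷ 23 ∷ 24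
  ∷ 25 ∷ 26 ∷ 27 ∷ 28 ∷ 29 ∷ 30 ∷ 31 ∷ 32 ∷ 33 ∷ 34 ∷ 35 ∷ 36 ∷ 37 ∷ 41 ∷ 59 ∷ 63 ∷ 61 ∷ 60 ∷ 62 ∷ 72 ∷ 56 ∷ 70
  ∷ 74 ∷ 66 ∷ [])
  (35449690848558 ∷ 35423921044782 ∷ 35423937779068 ∷ 35310918106382 ∷ 35423937803756 ∷ 35449690832302
  ∷ 35423921028526 ∷ 35423936747004 ∷ 5004552306572 ∷ 35285148302606 ∷ 35423937820012 ∷ 39847735508398
  ∷ 35791903293022 ∷ 35791953657614 ∷ 35310867742046 ∷ 39821965704622 ∷ 39821965702638 ∷ 39640243305870
  ∷ 145037335705064 ∷ 40189998071694 ∷ 90124641260924 ∷ 90124640228860 ∷ 89985851260174 ∷ 105814093878652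
  ∷ 90124641285612 ∷ 144900282382064 ∷ 145048508348400 ∷ 35285165047134 ∷ 144917412175244 ∷ 105814093903340
  ∷ 145054582676908 ∷ 105814094157304 ∷ 145037704542192 ∷ 70621264565758 ∷ 90124624510382 ∷ 70407298176754
  ∷ 105677460494072 ∷ 39683192978830 ∷ 105814094140920 ∷ 4986890092272 ∷ 105677460231804 ∷ 145080352355820
  ∷ 5004069961428 ∷ 90124641301868 ∷ 145048458163952 ∷ 105814093919596 ∷ 28573401896316 ∷ 145097532218796
  ∷ 28402408773368 ∷ 4987309522920 ∷ 145093505703308 ∷ 70638444451324 ∷ 28573402158584 ∷ 89985868004702
  ∷ 105814093895164 ∷ 110212138579434 ∷ 90124624002350 ∷ 28436768249468 ∷ 40189947739870 ∷ 145048240240120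
  ∷ 70621265876474 ∷ 171509911822826 ∷ 70553326540530 ∷ 28573401937260 ∷ 45074800416248 ∷ 70621265892858
  ∷ 70544737146866 ∷ 74805342631666 ∷ 145058709430228 ∷ 452179958422256 ∷ 452332865776618 ∷ 28573402306040
  ∷ 45074799105532 ∷ 74942781569010 ∷ 70957052952306 ∷ 171270198850298 ∷ 75019310315002 ∷ 28573402052076
  ∷ 452317833579496 ∷ 110006785472250 ∷ 452197573778142 ∷ 28438923607390 ∷ 171270307705586 ∷ 44955321456370
  ∷ 70553326557170 ∷ 45074800399864 ∷ 28333798414066 ∷ 452231984044940 ∷ 28573402043900 ∷ 452400772869098
  ∷ 44955321473010 ∷ 171514257123758 ∷ 452197138291412 ∷ 557766360685296 ∷ 45074799089148 ∷ 145045992617448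
  ∷ 557783540554452 ∷ 315857698388694 ∷ 74951370979314 ∷ 28577746844974 ∷ 315858134268510 ∷ 316061332568956
  ∷ 557784027093900 ∷ 315892544494350 ∷ 557766780115944 ∷ 74951370995442 ∷ 106158504181374 ∷ 171306764392846
  ∷ 315838908037874 ∷ 452231983979406 ∷ 452195527555826 ∷ 315855986784894 ∷ 316061332601708 ∷ 421444050472860
  ∷ 28577747353006 ∷ 171390566904818 ∷ 452195426827002 ∷ 75355097399026 ∷ 315855986817902 ∷ 145117396444650
  ∷ 421444100804308 ∷ 315855987047162 ∷ 421426920913650 ∷ 189093641692666 ∷ 145083036706286 ∷ 28454057646066
  ∷ 145100216577454 ∷ 145117530138106 ∷ 28438974102798 ∷ 421444100779734 ∷ 316061333093368 ∷ 145083170399742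
  ∷ 145082599978492 ∷ 452439477513134 ∷ 106158504181498 ∷ 233061138476462 ∷ 106158504214382 ∷ 188991342360562
  ∷ 316100037770030 ∷ 421444050734878 ∷ 421444587608846 ∷ 233061138474478 ∷ 232922365222286 ∷ 110556548628458
  ∷ 421443966824030 ∷ 110556548628218 ∷ 188991342376690 ∷ [])

block-22-38 : Block
block-22-38 = block (22 ∷ 38 ∷ [])
  (20 ∷ 0 ∷ 1 ∷ 2 ∷ 3 ∷ 4 ∷ 5 ∷ 6 ∷ 7 ∷ 8 ∷ 9 ∷ 10 ∷ 11 ∷ 12 ∷ 13 ∷ 14 ∷ 15 ∷ 16 ∷ 17 ∷ 18 ∷ 19 ∷ 21 ∷ 23 ∷ 24 ∷ 25
  ∷ 26 ∷ 27 ∷ 28 ∷ 29 ∷ 30 ∷ 31 ∷ 32 ∷ 33 ∷ 34 ∷ 35 ∷ 36 ∷ 37 ∷ 39 ∷ 41 ∷ 59 ∷ 43 ∷ 62 ∷ 63 ∷ 70 ∷ 49 ∷ 65 ∷ 72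
  ∷ 56 ∷ 74 ∷ 66 ∷ 69 ∷ [])
  (222988003267964 ∷ 636548481223272 ∷ 636507860708958 ∷ 636592651676650 ∷ 216583279737858 ∷ 216541410098194
  ∷ 86648577621372 ∷ 216543318441072 ∷ 223132016788860 ∷ 216509227105648 ∷ 216393097346412 ∷ 216516602821926
  ∷ 86786050129268 ∷ 216585322298406 ∷ 636520526232338 ∷ 86784034766192 ∷ 216586135993444 ∷ 636548422503032
  ∷ 216516737039650 ∷ 223132050345592 ∷ 216514593815810 ∷ 216585456516130 ∷ 216507083914514 ∷ 216534963416700
  ∷ 223132075509356 ∷ 223132109065832 ∷ 636595595873256 ∷ 786082003750520 ∷ 786082062470760 ∷ 223123477126512
  ∷ 636522669480816 ∷ 636528227167178 ∷ 216530569821556 ∷ 1191319645340582 ∷ 223125492489588 ∷ 86790443662972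
  ∷ 711289459588976 ∷ 1191319708320684 ∷ 579365243993968 ∷ 216359705767836 ∷ 1191252064158380 ∷ 216357655739758
  ∷ 216357524729820 ∷ 636527289741272 ∷ 86783770848858 ∷ 636548447668844 ∷ 1191251799861926 ∷ 86615160876638
  ∷ 711287048220442 ∷ 1191315383960486 ∷ 786082028916332 ∷ 346894715212678 ∷ 711287316397842 ∷ 636550624558002
  ∷ 636548388948604 ∷ 711275204521566 ∷ 346894778192780 ∷ 1191311065891750 ∷ 579333809057374 ∷ 786073430531952
  ∷ 786081970196092 ∷ 346886135763846 ∷ 222954586467934 ∷ 86615291919726 ∷ 654105483587268 ∷ 636510108823508
  ∷ 636547655150534 ∷ 636511183613892 ∷ 216514325639064 ∷ 1385298686461612 ∷ 86787123903846 ∷ 579364980076122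
  ∷ 579371652890236 ∷ 636528294341466 ∷ 346890453898124 ∷ 223126566239606 ∷ 86782963121522 ∷ 1191315384026028
  ∷ 346890453832582 ∷ 636512222719958 ∷ 711288387944306 ∷ 532143161562764 ∷ 636552763644912 ∷ 222954717541758
  ∷ 346886198743950 ∷ 579363908431450 ∷ 636510041780188 ∷ 579364172349298 ∷ 711285976575770 ∷ 1191208860675750
  ∷ 636508125998718 ∷ 346881874383750 ∷ 86792327229022 ∷ 1385292120283064 ∷ 532109877663370 ∷ 1946049616613036
  ∷ 1805329308256940 ∷ 579334074347134 ∷ 1191306804511654 ∷ 636519454588690 ∷ 346852850816642 ∷ 532144111572888
  ∷ 711315195899516 ∷ 86782699204186 ∷ 1191316190325670 ∷ 579373536456286 ∷ 223131845094986 ∷ 532125771652564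
  ∷ 711286244753170 ∷ 786041978826334 ∷ 711277385592732 ∷ 636527222697818 ∷ 711275469811326 ∷ 1191311128871854
  ∷ 636547588106846 ∷ 346850632095642 ∷ 346850766313098 ∷ 1805311864090278 ∷ 1805392495479724 ∷ 1805277506449062
  ∷ 532161073012180 ∷ 216506815737626 ∷ 636521597878066 ∷ 636514090290798 ∷ 346884990785438 ∷ 1385298422230694
  ∷ 786081664282186 ∷ 1805393300728742 ∷ 1191202548307898 ∷ 346893580720028 ∷ 1191307610876838 ∷ 223097718130286
  ∷ 532109751834522 ∷ 1946049352380070 ∷ 786081739779674 ∷ 216534699437662 ∷ 223131786374746 ∷ 1805277770747566
  ∷ 223131811540558 ∷ 786081764945486 ∷ 1191209124972206 ∷ 636529634127738 ∷ 1946015258971822 ∷ 223122405490034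
  ∷ 1385257760544698 ∷ 1385264064589478 ∷ 1385262181340842 ∷ 711314931920478 ∷ 1191245497980856 ∷ 1946014994738854
  ∷ 786042244116094 ∷ 223097453899342 ∷ 1191318510852028 ∷ 223131752820318 ∷ 786081706225246 ∷ 1191309920917438
  ∷ 786047407304270 ∷ 223130978709114 ∷ 223130714730074 ∷ 786072358895474 ∷ 786080668135002 ∷ 786047671537262
  ∷ 786080932114042 ∷ [])

block-20-22-38 : Block
block-20-22-38 = block (20 ∷ 22 ∷ 38 ∷ [])
  (39 ∷ 0 ∷ 1 ∷ 2 ∷ 3 ∷ 4 ∷ 5 ∷ 6 ∷ 7 ∷ 8 ∷ 9 ∷ 10 ∷ 11 ∷ 12 ∷ 13 ∷ 14 ∷ 15 ∷ 16 ∷ 17 ∷ 18 ∷ 19 ∷ 21 ∷ 23 ∷ 24 ∷ 25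
  ∷ 26 ∷ 27 ∷ 28 ∷ 29 ∷ 30 ∷ 31 ∷ 32 ∷ 33 ∷ 34 ∷ 35 ∷ 36 ∷ 37 ∷ 41 ∷ 59 ∷ 63 ∷ 43 ∷ 61 ∷ 62 ∷ 70 ∷ 49 ∷ 60 ∷ 65
  ∷ 72 ∷ 74 ∷ 56 ∷ 66 ∷ 69 ∷ [])
  (2680602398053756 ∷ 36372222031336 ∷ 1120193697274 ∷ 1188904801786 ∷ 571876535088620 ∷ 2769604046725608
  ∷ 2769645658350058 ∷ 17660049812180 ∷ 36376550421992 ∷ 571876535063932 ∷ 17895198289620 ∷ 571876535104876
  ∷ 285763960823180 ∷ 17895198256854 ∷ 571808218240636 ∷ 285832546065836 ∷ 2680602398094700 ∷ 17611999930100
  ∷ 17613073630966 ∷ 1193438124018 ∷ 17720447263476 ∷ 36372406581232 ∷ 571876535080444 ∷ 36377808123888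
  ∷ 17660049779414 ∷ 17720447222518 ∷ 54170489978608 ∷ 285854020771244 ∷ 8922352293374 ∷ 1189110323186
  ∷ 36377673971192 ∷ 18712585262834 ∷ 53079568285396 ∷ 8922352276990 ∷ 1193303971322 ∷ 572976046970360
  ∷ 18986119954162 ∷ 572976046953976 ∷ 36578513649640 ∷ 572907730130680 ∷ 285852007521676 ∷ 1193274725882
  ∷ 53895881553648 ∷ 1227948922362 ∷ 18785599117042 ∷ 27507067672306 ∷ 10030455166456 ∷ 53969969149680
  ∷ 608160416970218 ∷ 2752011860419560 ∷ 10021865215482 ∷ 36412252337642 ∷ 2752053472191466 ∷ 76298433062644
  ∷ 45167971121138 ∷ 2198621890796244 ∷ 9983601121266 ∷ 2680534081230460 ∷ 931220067955688 ∷ 944414207750632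
  ∷ 45206235231738 ∷ 27781944540914 ∷ 76346482944724 ∷ 2197513789233904 ∷ 36412318922234 ∷ 931151541433072
  ∷ 2198622100511692 ∷ 413900902209018 ∷ 413832191104506 ∷ 62966314565362 ∷ 1952331288268500 ∷ 285845430842860
  ∷ 2802631009129976 ∷ 1635672683437004 ∷ 76346482911958 ∷ 27580081592050 ∷ 1952331288243926 ∷ 2197513998949352
  ∷ 2802631009273336 ∷ 85078419916534 ∷ 2232698163395314 ∷ 62691437704946 ∷ 3877568093346544 ∷ 1635672474245844
  ∷ 608057740424954 ∷ 2784970506262264 ∷ 2751950795633402 ∷ 572048739827326 ∷ 3877644546927594 ∷ 2785038823086072
  ∷ 3877678501129194 ∷ 435298078480782 ∷ 150558928469262 ∷ 413905272133114 ∷ 2680602398201340 ∷ 2751943333901040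
  ∷ 3138003595920892 ∷ 2751950849962738 ∷ 381464438618096 ∷ 1635672683371470 ∷ 2680602398209516 ∷ 3877568303061992
  ∷ 2141464709553036 ∷ 9987895564274 ∷ 285834609483732 ∷ 3102269468005884 ∷ 413922481247738 ∷ 150628315348398
  ∷ 1332224689888014 ∷ 150628314840366 ∷ 1635672691628766 ∷ 76406880355062 ∷ 45172265564146 ∷ 76406880396020
  ∷ 1578515292478348 ∷ 1895173838589852 ∷ 1389382089341534 ∷ 572048739860334 ∷ 435401825102254 ∷ 413901107730418
  ∷ 368275675608816 ∷ 150558903270750 ∷ 1389381871565526 ∷ 3224847835956728 ∷ 2752012044973040 ∷ 400638257092338
  ∷ 1895173838589726 ∷ 1389382089366350 ∷ 1895174107028238 ∷ 3877567288048370 ∷ 1952331498249038 ∷ 413922615400434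
  ∷ 413957126198778 ∷ 3913962386389884 ∷ 3191821947086328 ∷ 3913962386422636 ∷ 285846554392060 ∷ 3191853895099898
  ∷ 381486886139384 ∷ 3912751662201586 ∷ 400711270946546 ∷ 381485762590184 ∷ 608332621479914 ∷ 2752010979619826
  ∷ 1578515292412814 ∷ 62764451624690 ∷ 285846773020142 ∷ 3174261709055994 ∷ 1952331221397086 ∷ 3877575827454714
  ∷ 573148251455226 ∷ 1578619039574958 ∷ 285846839604734 ∷ 3206705894086648 ∷ 381487020029936 ∷ 3224298080130552
  ∷ 3912760201607930 ∷ 3174229878159344 ∷ 3912862875286520 ∷ 2784936201115378 ∷ 435319553318286 ∷ 3174229886564080
  ∷ 3913859712973438 ∷ 3913859713006446 ∷ 381521464501738 ∷ 294651455974830 ∷ 3174227739129842 ∷ 381521531086330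
  ∷ 3206663334483698 ∷ 608332621479674 ∷ 435388940201390 ∷ 1332328437054254 ∷ 3206663334500338 ∷ 3174227739145970
  ∷ 2784996330805234 ∷ [])

-- Each source belongs to a subset J′ of `J`. A vertex that is hard for J′ is hard for `J` or lies
-- in `J`, so K_J contains all edges of K_J′ that avoid `J`, and the sets found for J′ can be used
-- again.
certificates : List Certificate
certificates =
  certificate block-G (block∅ ∷ [])
  ∷ certificate block-9 (block-9 ∷ block∅ ∷ [])
  ∷ certificate block-17 (block-17 ∷ block∅ ∷ [])
  ∷ certificate block-9-17 (block-9-17 ∷ block∅ ∷ block-9 ∷ block-17 ∷ [])
  ∷ certificate block-35 (block-35 ∷ block∅ ∷ [])
  ∷ certificate block-9-35 (block-9-35 ∷ block∅ ∷ block-9 ∷ [])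
  ∷ certificate block-17-35 (block-17-35 ∷ block∅ ∷ block-35 ∷ [])
  ∷ certificate block-9-17-35 (block-9-17-35 ∷ block∅ ∷ block-9 ∷ block-17 ∷ block-9-17 ∷ block-9-35 ∷ [])
  ∷ certificate block-20 (block-20 ∷ block∅ ∷ [])
  ∷ certificate block-22 (block-22 ∷ block∅ ∷ [])
  ∷ certificate block-20-22 (block-20-22 ∷ block∅ ∷ block-22 ∷ [])
  ∷ certificate block-38 (block-38 ∷ block∅ ∷ [])
  ∷ certificate block-20-38 (block-20-38 ∷ block∅ ∷ block-20 ∷ block-38 ∷ [])
  ∷ certificate block-22-38 (block-22-38 ∷ block∅ ∷ block-22 ∷ [])
  ∷ certificate block-20-22-38 (block-20-22-38 ∷ block∅ ∷ block-20 ∷ block-38 ∷ block-20-38 ∷ []) ∷ []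
block∅-valid : ValidBlock block∅
block∅-valid = valid refl

block-G-valid : ValidBlock block-G
block-G-valid = valid refl

block-9-valid : ValidBlock block-9
block-9-valid = valid refl

block-17-valid : ValidBlock block-17
block-17-valid = valid refl

block-9-17-valid : ValidBlock block-9-17
block-9-17-valid = valid refl

block-35-valid : ValidBlock block-35
block-35-valid = valid refl

block-9-35-valid : ValidBlock block-9-35
block-9-35-valid = valid refl

block-17-35-valid : ValidBlock block-17-35
block-17-35-valid = valid refl

block-9-17-35-valid : ValidBlock block-9-17-35
block-9-17-35-valid = valid refl

block-20-valid : ValidBlock block-20
block-20-valid = valid refl

block-22-valid : ValidBlock block-22
block-22-valid = valid refl

block-20-22-valid : ValidBlock block-20-22
block-20-22-valid = valid refl

block-38-valid : ValidBlock block-38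
block-38-valid = valid refl

block-20-38-valid : ValidBlock block-20-38
block-20-38-valid = valid refl

block-22-38-valid : ValidBlock block-22-38
block-22-38-valid = valid refl

block-20-22-38-valid : ValidBlock block-20-22-38
block-20-22-38-valid = valid refl

certificates-valid : All ValidCertificate certificates
certificates-valid =
  validCertificate block-G-valid (block∅-valid ∷ []) refl
  ∷ validCertificate block-9-valid (block-9-valid ∷ block∅-valid ∷ []) refl
  ∷ validCertificate block-17-valid (block-17-valid ∷ block∅-valid ∷ []) refl
  ∷ validCertificate block-9-17-valid (block-9-17-valid ∷ block∅-valid ∷ block-9-valid ∷ block-17-valid ∷ []) refl
  ∷ validCertificate block-35-valid (block-35-valid ∷ block∅-valid ∷ []) refl
  ∷ validCertificate block-9-35-valid (block-9-35-valid ∷ block∅-valid ∷ block-9-valid ∷ []) refl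
  ∷ validCertificate block-17-35-valid (block-17-35-valid ∷ block∅-valid ∷ block-35-valid ∷ []) refl
  ∷ validCertificate block-9-17-35-valid (block-9-17-35-valid ∷ block∅-valid ∷ block-9-valid ∷ block-17-valid ∷ block-9-17-valid ∷ block-9-35-valid ∷ []) refl
  ∷ validCertificate block-20-valid (block-20-valid ∷ block∅-valid ∷ []) refl
  ∷ validCertificate block-22-valid (block-22-valid ∷ block∅-valid ∷ []) refl
  ∷ validCertificate block-20-22-valid (block-20-22-valid ∷ block∅-valid ∷ block-22-valid ∷ []) refl
  ∷ validCertificate block-38-valid (block-38-valid ∷ block∅-valid ∷ []) refl
  ∷ validCertificate block-20-38-valid (block-20-38-valid ∷ block∅-valid ∷ block-20-valid ∷ block-38-valid ∷ []) refl
  ∷ validCertificate block-22-38-valid (block-22-38-valid ∷ block∅-valid ∷ block-22-valid ∷ []) refl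
  ∷ validCertificate block-20-22-38-valid (block-20-22-38-valid ∷ block∅-valid ∷ block-20-valid ∷ block-38-valid ∷ block-20-38-valid ∷ []) refl ∷ []

all-covered : all (covered certificates) (sublists D) ≡ true
all-covered = refl

theorem5 : Σ (Graph 77) (λ G → TriangleFree G × HasChromaticNumber G 7)
theorem5 = H , H-triangle-free , H-colourable , H-not-colourable certificates certificates-valid all-covered
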